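{- Let $\alpha$ be a composition of $n\ge1$ and let $S$ be the antipode of $\mathfrak{m}\mathrm{QSym}$. Then $$S(\tilde L_\alpha)=\sum_\beta(-1)^{|\beta|}M_{\beta,\omega(\alpha)}\,\tilde L_\beta,$$ where the (possibly infinite) sum is over all compositions $\beta$.
   Context: A composition is a finite sequence of positive integers $\alpha=(\alpha_1,\dots,\alpha_k)$, $|\alpha|=\sum\alpha_i$. For $\alpha$ a composition of $n$, $S_\alpha=\{\alpha_1,\alpha_1+\alpha_2,\dots,\alpha_1+\dots+\alpha_{k-1}\}\subseteq[n-1]$; for $D=\{s_1<\dots<s_j\}\subseteq[n-1]$, $\mathcal{C}(D)=(s_1,s_2-s_1,\dots,n-s_j)$. For a word $u=u_1\cdots u_m$ with no two equal consecutive letters, $\mathcal{C}(u)=\mathcal{C}(\{i:u_i>u_{i+1}\})$. $w_\alpha$ is any permutation of $[n]$ with $\mathcal{C}(w_\alpha)=\alpha$. Multi-fundamental quasisymmetric functions: for $w\in\mathfrak S_n$ and a chain $p_1<\dots<p_n$, a set-valued partition is a map $\sigma$ assigning to each $p_i$ a finite nonempty set of positive integers such that $\max\sigma(p_i)\le\min\sigma(p_{i+1})$ if $w_i<w_{i+1}$ and $\max\sigma(p_i)<\min\sigma(p_{i+1})$ if $w_i>w_{i+1}$. Then $\tilde L_\alpha=\sum_\sigma\prod_{j\ge1}x_j^{\#\{i:\,j\in\sigma(p_i)\}}\in\mathbb{Z}[[x_1,x_2,\dots]]$ for $w=w_\alpha$ (independent of the choice of $w_\alpha$); $\tilde L_\emptyset=1$.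 $\mathfrak{m}\mathrm{QSym}$ is the set of all (possibly infinite) $\mathbb{Z}$-linear combinations $\sum_\alpha c_\alpha\tilde L_\alpha$; $\{\tilde L_\alpha\}$ is a continuous basis. It is a (completed) Hopf algebra with the product of power series, coproduct $\Delta(f)=f(x_1,x_2,\dots,y_1,y_2,\dots)$ in the completed tensor product (explicitly $\Delta\tilde L_\alpha=\sum\tilde L_{\mathcal{C}(u)}\otimes\tilde L_{\mathcal{C}(u')}$ over $u\otimes u'$ of the forms $w_1\cdots w_i\otimes w_{i+1}\cdots w_n$, $0\le i\le n$, or $w_1\cdots w_i\otimes w_i\cdots w_n$, $1\le i\le n$, where $w=w_\alpha$), counit the constant term, and antipode $S$ the continuous linear map with $\sum S(f_1)f_2=\epsilon(f)=\sum f_1S(f_2)$. $\omega(\alpha)$ is the composition of $n$ with $S_{\omega(\alpha)}=[n-1]\setminus S_{(\alpha_k,\dots,\alpha_1)}$. Mergings: for a nonempty composition $\alpha$ of $n$ let $a(\alpha)=h^{\alpha_1-1}vh^{\alpha_2-1}v\cdots vh^{\alpha_k-1}\in\{h,v\}^{n-1}$ (encoding its ribbon diagram: rows of lengths $\alpha_1,\dots,\alpha_k$ from bottom to top, first box of each row directly above the last box of the row below); each word in $\{h,v\}^{m-1}$ is $a(\beta)$ for a unique composition $\beta$ of $m$. $M_{\alpha,\beta}$ is the number of subsets $X\subseteq[n-1]$ such that deleting the letters of $a(\alpha)$ in positions $X$ yields $a(\beta)$ (the number of ways to obtain ribbon $\beta$ from ribbon $\alpha$ by merging edge-adjacent boxes).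 -}

module Defs where

open import Data.Bool using (Bool; true; false; _∧_; if_then_else_; not)
open import Data.Nat as ℕ using (ℕ; zero; suc; _∸_; _≡ᵇ_; _<ᵇ_; _⊔_; _⊓_)
open import Data.Integer as ℤ using (ℤ; +_; -_)
open import Data.List using (List; []; _∷_; _++_; map; length; concatMap;
  foldr; replicate; take; drop; reverse; upTo)
open import Data.List.Properties using (≡-dec)
open import Relation.Nullary using (does)
open import Data.Product using (_×_; _,_; proj₁; proj₂)
open import Relation.Binary.PropositionalEquality using (_≡_)

-- Compositions.  A composition (α₁,…,αₖ) is encoded as the list
-- (α₁ ∸ 1, …, αₖ ∸ 1); i.e. a stored entry a stands for the part a+1.
-- This is a bijection between List ℕ and compositions.

filter : {A : Set} → (A → Bool) → List A → List A
filter p []       = []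
filter p (x ∷ xs) = if p x then x ∷ filter p xs else filter p xs

any : {A : Set} → (A → Bool) → List A → Bool
any p = foldr (λ x b → if p x then true else b) false

all : {A : Set} → (A → Bool) → List A → Bool
all p = foldr (λ x b → p x ∧ b) true

Composition : Set
Composition = List ℕ

parts : Composition → List ℕ
parts = map suc

size : Composition → ℕ
size α = foldr ℕ._+_ 0 (parts α)

range : ℕ → List ℕ
range k = map suc (upTo k)

setS : Composition → List ℕ
setS α = go 0 α
  where
  go : ℕ → List ℕ → List ℕ
  go acc []          = []
  go acc (a ∷ [])    = []
  go acc (a ∷ b ∷ r) = (acc ℕ.+ suc a) ∷ go (acc ℕ.+ suc a) (b ∷ r)

-- C(D) for D = {s₁<⋯<sⱼ} ⊆ [n-1] (given as an increasing list); C(∅ ⊆ [0-1]) for n = 0 is ∅.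
compD : ℕ → List ℕ → Composition
compD zero    D = []
compD (suc n) D = go 0 D
  where
  go : ℕ → List ℕ → Composition
  go p []      = (suc n ∸ p) ∸ 1 ∷ []
  go p (s ∷ D) = (s ∸ p) ∸ 1 ∷ go s D

descents : List ℕ → List ℕ
descents = go 1
  where
  go : ℕ → List ℕ → List ℕ
  go i (x ∷ y ∷ r) = if y <ᵇ x then i ∷ go (suc i) (y ∷ r) else go (suc i) (y ∷ r)
  go i _           = []

Cw : List ℕ → Composition
Cw u = compD (length u) (descents u)

-- a specific permutation w_α with C(w_α) = α: the blocks of α, each increasing,
-- the first block using the largest values, the last block the smallest.
wα : Composition → List ℕ
wα []      = []
wα (a ∷ r) = map (ℕ._+ size r) (range (suc a)) ++ wα r

ω : Composition → Composition
ω α = compD (size α)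
        (filter (λ i → not (any (i ≡ᵇ_) (setS (reverse α)))) (range (size α ∸ 1)))

-- Formal power series in x₁,x₂,… with ℤ coefficients.  A monomial
-- x₁^{m₁}⋯x_N^{m_N} is a list (m₁,…,m_N); a series is its coefficient
-- function, and two series are equal iff all coefficients agree.

Monomial : Set
Monomial = List ℕ

PS : Set
PS = Monomial → ℤ

_≈_ : PS → PS → Set
f ≈ g = ∀ m → f m ≡ g m

eqL : List ℕ → List ℕ → Bool
eqL x y = does (≡-dec ℕ._≟_ x y)

isZeroMon : Monomial → Bool
isZeroMon = all (_≡ᵇ 0)

zeroPS : PS
zeroPS _ = + 0

onePS : PS
onePS m = if isZeroMon m then + 1 else + 0

sumℤ : List ℤ → ℤ
sumℤ = foldr ℤ._+_ (+ 0)

sumPS : List PS → PS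
sumPS fs m = sumℤ (map (λ f → f m) fs)

below : Monomial → List Monomial
below []      = [] ∷ []
below (k ∷ m) = concatMap (λ i → map (i ∷_) (below m)) (upTo (suc k))

_⋆_ : PS → PS → PS
(f ⋆ g) m = sumℤ (map (λ a → f a ℤ.* g (Data.List.zipWith _∸_ m a)) (below m))

degree : Monomial → ℕ
degree m = foldr ℕ._+_ 0 m

-- all subsets of a list (as sublists, so increasing if the list is)
subsetsOf : List ℕ → List (List ℕ)
subsetsOf []       = [] ∷ []
subsetsOf (x ∷ xs) = subsetsOf xs ++ map (x ∷_) (subsetsOf xs)

nonemptyᵇ : List ℕ → Bool
nonemptyᵇ []      = false
nonemptyᵇ (_ ∷ _) = true

neSubsets : ℕ → List (List ℕ)
neSubsets N = filter nonemptyᵇ (subsetsOf (range N))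

tuples : {A : Set} → ℕ → List A → List (List A)
tuples zero    xs = [] ∷ []
tuples (suc n) xs = concatMap (λ x → map (x ∷_) (tuples n xs)) xs

maxL : List ℕ → ℕ
maxL = foldr _⊔_ 0

minL : List ℕ → ℕ
minL []       = 0
minL (x ∷ xs) = foldr _⊓_ x xs

-- σ = (σ(p₁),…,σ(pₙ)) satisfies the set-valued partition conditions for w
validSVP : List ℕ → List (List ℕ) → Bool
validSVP (a ∷ b ∷ w) (s ∷ t ∷ σ) =
  (if a <ᵇ b then maxL s ℕ.≤ᵇ minL t else maxL s <ᵇ minL t) ∧ validSVP (b ∷ w) (t ∷ σ)
validSVP _ _ = true

content : ℕ → List (List ℕ) → Monomial
content N σ = map (λ j → length (filter (λ s → any (j ≡ᵇ_) s) σ)) (range N)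

-- coefficient of the monomial m in the sum over set-valued partitions for w
-- (a partition has weight m only if all its values are ≤ length m)
LtW : List ℕ → PS
LtW w m = + length (filter (λ σ → validSVP w σ ∧ eqL (content (length m) σ) m)
                           (tuples (length w) (neSubsets (length m))))

Lt : Composition → PS
Lt α = LtW (wα α)

εL : Composition → PS
εL []      = onePS
εL (_ ∷ _) = zeroPS

coprodTerms : Composition → List (Composition × Composition)
coprodTerms α =
  map (λ i → Cw (take i w) , Cw (drop i w)) (upTo (suc n)) ++
  map (λ i → Cw (take i w) , Cw (drop (i ∸ 1) w)) (range n)
  where
  w = wα α
  n = length w

-- T : Composition → PS gives the values T(L̃_α) of a continuous linear map
-- on the continuous basis.  It satisfies the antipode axioms
-- Σ S(f₁) f₂ = ε(f) = Σ f₁ S(f₂) iff they hold for every basis element f = L̃_α.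
IsAntipode : (Composition → PS) → Set
IsAntipode T =
  ∀ α → (sumPS (map (λ p → T (proj₁ p) ⋆ Lt (proj₂ p)) (coprodTerms α)) ≈ εL α)
      × (sumPS (map (λ p → Lt (proj₁ p) ⋆ T (proj₂ p)) (coprodTerms α)) ≈ εL α)

data Letter : Set where
  h v : Letter

eqLetter : Letter → Letter → Bool
eqLetter h h = true
eqLetter v v = true
eqLetter _ _ = false

eqWord : List Letter → List Letter → Bool
eqWord []       []       = true
eqWord (x ∷ xs) (y ∷ ys) = eqLetter x y ∧ eqWord xs ys
eqWord _        _        = false

aWord : Composition → List Letter
aWord []          = []
aWord (a ∷ [])    = replicate a h
aWord (a ∷ b ∷ r) = replicate a h ++ v ∷ aWord (b ∷ r)

-- all subsets X of the positions of a word of length k, as deletion masks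
masks : ℕ → List (List Bool)
masks zero    = [] ∷ []
masks (suc k) = concatMap (λ b → map (b ∷_) (masks k)) (true ∷ false ∷ [])

deleteAt : List Bool → List Letter → List Letter
deleteAt (true  ∷ X) (_ ∷ u) = deleteAt X u
deleteAt (false ∷ X) (x ∷ u) = x ∷ deleteAt X u
deleteAt _           u       = u

-- M_{α,β}, defined for nonempty α, β; set to 0 if exactly one is empty, 1 if both are
M : Composition → Composition → ℕ
M []      []      = 1
M []      (_ ∷ _) = 0
M (_ ∷ _) []      = 0
M α@(_ ∷ _) β@(_ ∷ _) =
  length (filter (λ X → eqWord (deleteAt X (aWord α)) (aWord β))
                 (masks (length (aWord α))))

-- Infinite sums Σ_β c_β L̃_β.  Since every σ(pᵢ) is nonempty, the coefficient
-- of m in L̃_β vanishes when |β| > degree m, so the coefficient of m in the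
-- sum is the finite sum over compositions β with |β| ≤ degree m.

-- all compositions of n, via the bijection D ↦ C(D) from subsets of [n-1]
compositionsOf : ℕ → List Composition
compositionsOf n = map (compD n) (subsetsOf (range (n ∸ 1)))

compositionsUpTo : ℕ → List Composition
compositionsUpTo d = concatMap compositionsOf (upTo (suc d))

ΣL : (Composition → ℤ) → PS
ΣL c m = sumℤ (map (λ β → c β ℤ.* Lt β m) (compositionsUpTo (degree m)))

sgn : ℕ → ℤ
sgn k = (- (+ 1)) ℤ.^ k

{-# OPTIONS --safe #-}

-- Encode a nonempty composition by its word in h and v, and functions on words as noncommutative
-- power series in h and v. Put E = 1 + h + v. The cuts of a ribbon into two nonempty pieces, at a
-- box or between two boxes, amount to the product F E G, so the antipode equation for L and S reads
-- (1 + E L) (1 + E S) = 1. Extracting the first variable x gives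
--   1 + E L = (1 + E (1 − x h)⁻¹ x) (1 + E L′),
-- with L′ in the remaining variables; inverting one variable at a time expresses 1 + E S as a
-- product of the factors 1 − x E (1 + x (1 + v))⁻¹ in the opposite order. On the other side, summing
-- over mergings with signs is the substitution h ↦ −(1 + h), v ↦ −(1 + v), followed by a sign, and
-- turns the factors of 1 + E L into 1 − x E (1 + x (1 + h))⁻¹. Reversing words and exchanging h
-- and v, which is ω, matches the two products.

module Submission where

open import Defs
open import Data.List using (List; []; _∷_)
open import Data.Integer using (+_)
open import Data.Integer using (_*_)
open import Relation.Binary.PropositionalEquality using (_≢_)

open import Algebra.Properties.AbelianGroup using (∙-cancelˡ)
open import Data.Bool using (Bool; true; false; if_then_else_; _∧_; not; T)
open import Data.Empty using (⊥-elim)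
open import Data.Integer as ℤ using (ℤ; _+_; -_; 0ℤ; 1ℤ; -1ℤ)
import Data.Integer.Properties as ℤₚ
open import Data.Integer.Tactic.RingSolver using (solve-∀)
open import Data.List using (_++_; _∷ʳ_; map; concatMap; upTo; applyUpTo; zipWith; length; foldr;
  replicate; take; drop; reverse)
open import Data.List.Properties using (map-∘; map-cong; map-++; map-cong-local; map-applyUpTo;
  length-map; length-reverse; unfold-reverse; reverse-++; ++-assoc)
open import Data.List.Relation.Unary.All as All using (All; []; _∷_)
open import Data.List.Relation.Unary.All.Properties using ()
  renaming (++⁺ to All-++⁺; map⁺ to All-map⁺)
open import Data.Nat as ℕ using (ℕ; zero; suc; _∸_; _<_; _≤_; _<ᵇ_; _≤ᵇ_; _≡ᵇ_; _⊓_; _⊔_; s≤s; z≤n)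
open import Data.Nat.GeneralisedArithmetic using (fold)
import Data.Nat.Properties as ℕₚ
open import Data.Product using (_×_; _,_; proj₁; proj₂)
open import Data.Unit using (tt)
open import Function using (_∘_; const)
open import Relation.Binary.PropositionalEquality
open import Relation.Nullary using (¬_)

open ≡-Reasoning

-- Finite sums

-- The letter h drops out of the inverse because E - h = 1 + v: with A = (1 - x h)⁻¹ x one has (1 +
-- E A)⁻¹ = 1 - E (A⁻¹ + E)⁻¹ and A⁻¹ + E = x⁻¹ (1 + x (1 + v)). The substitution for mergings sends
-- E to 1 - (1 + h) - (1 + v) = -E. A word of length n has n + 1 boxes, so the sign of the sum
-- contributes one further -1, and 1 + E L becomes 1 + E P, with P the claimed sum before
-- transposition. Transposing gives 1 + Pᵗ E, whereas the antipode equation determines 1 + E S. The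
-- two recursions therefore match only after E is carried across by E (1 + Pᵗ E) = (1 + E Pᵗ) E;
-- then S = Pᵗ because E is invertible. All identities are read at one monomial, so that each
-- induction over the variables is an induction on a list of exponents.

∑ : {A : Set} → List A → (A → ℤ) → ℤ
∑ xs f = sumℤ (map f xs)

∑< : ℕ → (ℕ → ℤ) → ℤ
∑< zero    f = 0ℤ
∑< (suc n) f = f 0 + ∑< n (f ∘ suc)

∑-cong : {A : Set} (xs : List A) {f g : A → ℤ} → f ≗ g → ∑ xs f ≡ ∑ xs g
∑-cong xs e = cong sumℤ (map-cong e xs)

∑-map : {A B : Set} (g : A → B) (f : B → ℤ) (xs : List A) → ∑ (map g xs) f ≡ ∑ xs (f ∘ g)
∑-map g f xs = cong sumℤ (sym (map-∘ xs))

∑-++ : {A : Set} (f : A → ℤ) (xs ys : List A) → ∑ (xs ++ ys) f ≡ ∑ xs f + ∑ ys f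
∑-++ f []       ys = sym (ℤₚ.+-identityˡ _)
∑-++ f (x ∷ xs) ys = trans (cong (λ z → f x + z) (∑-++ f xs ys)) (sym (ℤₚ.+-assoc (f x) _ _))

∑-concatMap : {A B : Set} (g : A → List B) (f : B → ℤ) (xs : List A) →
  ∑ (concatMap g xs) f ≡ ∑ xs (λ x → ∑ (g x) f)
∑-concatMap g f []       = refl
∑-concatMap g f (x ∷ xs) =
  trans (∑-++ f (g x) (concatMap g xs)) (cong (λ z → ∑ (g x) f + z) (∑-concatMap g f xs))

∑-linear : {A : Set} (xs : List A) (x y : ℤ) (f g : A → ℤ) →
  ∑ xs (λ a → x * f a + y * g a) ≡ x * ∑ xs f + y * ∑ xs g
∑-linear []       x y f g = lemma x y
  where
  lemma : ∀ x y → 0ℤ ≡ x * 0ℤ + y * 0ℤ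
  lemma = solve-∀
∑-linear (a ∷ xs) x y f g =
  trans (cong (λ z → x * f a + y * g a + z) (∑-linear xs x y f g))
        (lemma x y (f a) (g a) (∑ xs f) (∑ xs g))
  where
  lemma : ∀ x y p q r s → x * p + y * q + (x * r + y * s) ≡ x * (p + r) + y * (q + s)
  lemma = solve-∀

∑<-cong : ∀ n {f g : ℕ → ℤ} → f ≗ g → ∑< n f ≡ ∑< n g
∑<-cong zero    e = refl
∑<-cong (suc n) e = cong₂ _+_ (e 0) (∑<-cong n (e ∘ suc))

∑<-+ : ∀ n (f g : ℕ → ℤ) → ∑< n (λ i → f i + g i) ≡ ∑< n f + ∑< n g
∑<-+ zero    f g = refl
∑<-+ (suc n) f g =
  trans (cong (λ z → f 0 + g 0 + z) (∑<-+ n (f ∘ suc) (g ∘ suc))) (lemma (f 0) (g 0) _ _)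
  where
  lemma : ∀ p q r s → p + q + (r + s) ≡ p + r + (q + s)
  lemma = solve-∀

∑<-zero : ∀ n {f : ℕ → ℤ} → (∀ i → f i ≡ 0ℤ) → ∑< n f ≡ 0ℤ
∑<-zero zero    e = refl
∑<-zero (suc n) e = cong₂ _+_ (e 0) (∑<-zero n (e ∘ suc))

∑<-last : ∀ n (f : ℕ → ℤ) → ∑< (suc n) f ≡ ∑< n f + f n
∑<-last zero    f = trans (ℤₚ.+-identityʳ (f 0)) (sym (ℤₚ.+-identityˡ (f 0)))
∑<-last (suc n) f =
  trans (cong (λ z → f 0 + z) (∑<-last n (f ∘ suc))) (sym (ℤₚ.+-assoc (f 0) _ _))

∑-applyUpTo : {A : Set} (f : A → ℤ) (g : ℕ → A) (n : ℕ) →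
  ∑ (applyUpTo g n) f ≡ ∑< n (f ∘ g)
∑-applyUpTo f g zero    = refl
∑-applyUpTo f g (suc n) = cong (λ z → f (g 0) + z) (∑-applyUpTo f (g ∘ suc) n)

-- Power series

⋆-peel : ∀ f g k m →
  (f ⋆ g) (k ∷ m) ≡ ∑< (suc k) (λ i → ((f ∘ (i ∷_)) ⋆ (g ∘ ((k ∸ i) ∷_))) m)
⋆-peel f g k m = begin
  ∑ (concatMap (λ i → map (i ∷_) (below m)) (upTo (suc k))) F
    ≡⟨ ∑-concatMap (λ i → map (i ∷_) (below m)) F (upTo (suc k)) ⟩
  ∑ (upTo (suc k)) (λ i → ∑ (map (i ∷_) (below m)) F)
    ≡⟨ ∑-cong (upTo (suc k)) (λ i → ∑-map (i ∷_) F (below m)) ⟩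
  ∑ (upTo (suc k)) (λ i → ∑ (below m) (F ∘ (i ∷_)))
    ≡⟨ ∑-applyUpTo (λ i → ∑ (below m) (F ∘ (i ∷_))) (λ i → i) (suc k) ⟩
  ∑< (suc k) (λ i → ((f ∘ (i ∷_)) ⋆ (g ∘ ((k ∸ i) ∷_))) m) ∎
  where
  F : Monomial → ℤ
  F a = f a * g (zipWith _∸_ (k ∷ m) a)

⋆-cong : ∀ {f f′ g g′} → f ≗ f′ → g ≗ g′ → (f ⋆ g) ≗ (f′ ⋆ g′)
⋆-cong e e′ m = ∑-cong (below m) (λ a → cong₂ _*_ (e a) (e′ _))

⋆-linearˡ : ∀ x y f f′ g m →
  ((λ b → x * f b + y * f′ b) ⋆ g) m ≡ x * (f ⋆ g) m + y * (f′ ⋆ g) m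
⋆-linearˡ x y f f′ g m =
  trans (∑-cong (below m) (λ a → lemma x y (f a) (f′ a) (g (zipWith _∸_ m a))))
        (∑-linear (below m) x y _ _)
  where
  lemma : ∀ x y p q r → (x * p + y * q) * r ≡ x * (p * r) + y * (q * r)
  lemma = solve-∀

⋆-scaleˡ : ∀ x f g m → ((λ b → x * f b) ⋆ g) m ≡ x * (f ⋆ g) m
⋆-scaleˡ x f g m =
  trans (⋆-cong {g = g} (λ b → sym (lemma x (f b))) (λ _ → refl) m)
  (trans (⋆-linearˡ x 0ℤ f f g m) (lemma x _))
  where
  lemma : ∀ x p → x * p + 0ℤ * p ≡ x * p
  lemma = solve-∀

⋆-zeroˡ : ∀ {f} g → (∀ m → f m ≡ 0ℤ) → ∀ m → (f ⋆ g) m ≡ 0ℤ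
⋆-zeroˡ {f} g e m =
  trans (⋆-cong {g = g} (λ b → trans (e b) (sym (ℤₚ.*-zeroˡ (f b)))) (λ _ → refl) m)
  (trans (⋆-scaleˡ 0ℤ f g m) (ℤₚ.*-zeroˡ ((f ⋆ g) m)))

⋆-identityˡ : ∀ g m → (onePS ⋆ g) m ≡ g m
⋆-identityˡ g []      = trans (ℤₚ.+-identityʳ _) (ℤₚ.*-identityˡ (g []))
⋆-identityˡ g (k ∷ m) = begin
  (onePS ⋆ g) (k ∷ m)
    ≡⟨ ⋆-peel onePS g k m ⟩
  (onePS ⋆ (g ∘ (k ∷_))) m + ∑< k (λ i → ((onePS ∘ (suc i ∷_)) ⋆ (g ∘ ((k ∸ suc i) ∷_))) m)
    ≡⟨ cong₂ _+_ (⋆-identityˡ (g ∘ (k ∷_)) m)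
         (∑<-zero k (λ i → ⋆-zeroˡ (g ∘ ((k ∸ suc i) ∷_)) (λ _ → refl) m)) ⟩
  g (k ∷ m) + 0ℤ
    ≡⟨ ℤₚ.+-identityʳ _ ⟩
  g (k ∷ m) ∎

-- Noncommutative series in h and v

Word : Set
Word = List Letter

Series : Set
Series = Word → ℤ

one : Series
one []      = 1ℤ
one (_ ∷ _) = 0ℤ

-- Left and right multiplication by x + κ(h) h + κ(v) v.

lin : ℤ → (Letter → ℤ) → Series → Series
lin x κ F []      = x * F []
lin x κ F (c ∷ a) = x * F (c ∷ a) + κ c * F a

linʳ : ℤ → (Letter → ℤ) → Series → Series
linʳ x κ F []          = x * F []
linʳ x κ F (c ∷ [])    = x * F (c ∷ []) + κ c * F []
linʳ x κ F (c ∷ d ∷ a) = linʳ x κ (F ∘ (c ∷_)) (d ∷ a)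

δ : Letter → Letter → ℤ
δ h h = 1ℤ
δ v v = 1ℤ
δ _ _ = 0ℤ

𝐄 −𝐄 : Series → Series
𝐄 = lin 1ℤ (const 1ℤ)
−𝐄 = lin -1ℤ (const -1ℤ)

-- The factor is -(1 + c), the image of c under the substitution for mergings; it is not -1 + c.
−1+ : Letter → Series → Series
−1+ c = lin -1ℤ (λ d → - δ c d)

prefix : Letter → Series → Series
prefix c = lin 0ℤ (δ c)

𝐄ʳ −𝐄ʳ : Series → Series
𝐄ʳ = linʳ 1ℤ (const 1ℤ)
−𝐄ʳ = linʳ -1ℤ (const -1ℤ)

−1+ʳ : Letter → Series → Series
−1+ʳ c = linʳ -1ℤ (λ d → - δ c d)

lin-cong : ∀ x κ {F G} → F ≗ G → lin x κ F ≗ lin x κ G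
lin-cong x κ e []      = cong (x *_) (e [])
lin-cong x κ e (c ∷ a) = cong₂ _+_ (cong (x *_) (e (c ∷ a))) (cong (κ c *_) (e a))

linʳ-cong : ∀ x κ {F G} → F ≗ G → linʳ x κ F ≗ linʳ x κ G
linʳ-cong x κ e []          = cong (x *_) (e [])
linʳ-cong x κ e (c ∷ [])    = cong₂ _+_ (cong (x *_) (e (c ∷ []))) (cong (κ c *_) (e []))
linʳ-cong x κ e (c ∷ d ∷ a) = linʳ-cong x κ (e ∘ (c ∷_)) (d ∷ a)

lin-linear : ∀ x κ y z F G a →
  lin x κ (λ b → y * F b + z * G b) a ≡ y * lin x κ F a + z * lin x κ G a
lin-linear x κ y z F G [] = lemma x y z (F []) (G [])
  where
  lemma : ∀ x y z p q → x * (y * p + z * q) ≡ y * (x * p) + z * (x * q)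
  lemma = solve-∀
lin-linear x κ y z F G (c ∷ a) = lemma x (κ c) y z (F (c ∷ a)) (G (c ∷ a)) (F a) (G a)
  where
  lemma : ∀ x k y z p q r s → x * (y * p + z * q) + k * (y * r + z * s)
        ≡ y * (x * p + k * r) + z * (x * q + k * s)
  lemma = solve-∀

linʳ-linear : ∀ x κ y z F G a →
  linʳ x κ (λ b → y * F b + z * G b) a ≡ y * linʳ x κ F a + z * linʳ x κ G a
linʳ-linear x κ y z F G []       = lin-linear x κ y z F G []
linʳ-linear x κ y z F G (c ∷ []) = lin-linear x κ y z F G (c ∷ [])
linʳ-linear x κ y z F G (c ∷ d ∷ a) =
  linʳ-linear x κ y z (F ∘ (c ∷_)) (G ∘ (c ∷_)) (d ∷ a)

lin-+ : ∀ x κ F G a → lin x κ (λ b → F b + G b) a ≡ lin x κ F a + lin x κ G a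
lin-+ x κ F G a = begin
  lin x κ (λ b → F b + G b) a
    ≡⟨ lin-cong x κ (λ b → sym (lemma (F b) (G b))) a ⟩
  lin x κ (λ b → 1ℤ * F b + 1ℤ * G b) a
    ≡⟨ lin-linear x κ 1ℤ 1ℤ F G a ⟩
  1ℤ * lin x κ F a + 1ℤ * lin x κ G a
    ≡⟨ lemma (lin x κ F a) (lin x κ G a) ⟩
  lin x κ F a + lin x κ G a ∎
  where
  lemma : ∀ p q → 1ℤ * p + 1ℤ * q ≡ p + q
  lemma = solve-∀

lin-scaleʳ : ∀ x κ F s a → lin x κ (λ b → F b * s) a ≡ lin x κ F a * s
lin-scaleʳ x κ F s []      = sym (ℤₚ.*-assoc x (F []) s)
lin-scaleʳ x κ F s (c ∷ a) = lemma x (κ c) (F (c ∷ a)) (F a) s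
  where
  lemma : ∀ x k p q s → x * (p * s) + k * (q * s) ≡ (x * p + k * q) * s
  lemma = solve-∀

lin-zero : ∀ x κ {F} → (∀ a → F a ≡ 0ℤ) → ∀ a → lin x κ F a ≡ 0ℤ
lin-zero x κ e a =
  trans (lin-cong x κ {G = λ _ → 0ℤ * 0ℤ} e a)
  (trans (lin-scaleʳ x κ (const 0ℤ) 0ℤ a) (ℤₚ.*-zeroʳ (lin x κ (const 0ℤ) a)))

-- Associativity of the product of series. On a word of one letter both factors act on the same
-- letter, hence the separate case.
lin-linʳ-comm : ∀ x κ y μ F → lin x κ (linʳ y μ F) ≗ linʳ y μ (lin x κ F)
lin-linʳ-comm x κ y μ F [] = lemma x y (F [])
  where
  lemma : ∀ x y p → x * (y * p) ≡ y * (x * p)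
  lemma = solve-∀
lin-linʳ-comm x κ y μ F (c ∷ []) = lemma x y (κ c) (μ c) (F (c ∷ [])) (F [])
  where
  lemma : ∀ x y k l p q → x * (y * p + l * q) + k * (y * q) ≡ y * (x * p + k * q) + l * (x * q)
  lemma = solve-∀
lin-linʳ-comm x κ y μ F (c ∷ d ∷ a) = sym (linʳ-linear y μ x (κ c) (F ∘ (c ∷_)) F (d ∷ a))

-- Multiplied by the unit from either side, the factor is itself. Through this lemma left
-- multiplications become right ones.
lin-one : ∀ x κ → lin x κ one ≗ linʳ x κ one
lin-one x κ []          = refl
lin-one x κ (c ∷ [])    = refl
lin-one x κ (c ∷ d ∷ a) = begin
  x * 0ℤ + κ c * 0ℤ                                 ≡⟨ lemma x (κ c) ⟩
  0ℤ                                                ≡⟨ linʳ-linear x κ 0ℤ 0ℤ one one (d ∷ a) ⟨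
  linʳ x κ (λ b → 0ℤ * one b + 0ℤ * one b) (d ∷ a)
    ≡⟨ linʳ-cong x κ (λ b → zero-zero (one b)) (d ∷ a) ⟩
  linʳ x κ (const 0ℤ) (d ∷ a)                       ∎
  where
  lemma : ∀ x k → x * 0ℤ + k * 0ℤ ≡ 0ℤ
  lemma = solve-∀
  zero-zero : ∀ p → 0ℤ * p + 0ℤ * p ≡ 0ℤ
  zero-zero = solve-∀

-- E has constant term 1, so the coefficients of F are recovered from those of E F by induction on
-- the length of the word.
𝐄-cancel : ∀ {F G} → 𝐄 F ≗ 𝐄 G → F ≗ G
𝐄-cancel e [] = ℤₚ.*-cancelˡ-≡ 1ℤ _ _ (e [])
𝐄-cancel {F} {G} e (c ∷ a) = begin
  F (c ∷ a)                                    ≡⟨ lemma (F (c ∷ a)) (F a) ⟩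
  1ℤ * F (c ∷ a) + 1ℤ * F a + - F a            ≡⟨ cong₂ (λ p q → p + - q) (e (c ∷ a)) (𝐄-cancel e a) ⟩
  1ℤ * G (c ∷ a) + 1ℤ * G a + - G a            ≡⟨ lemma (G (c ∷ a)) (G a) ⟨
  G (c ∷ a) ∎
  where
  lemma : ∀ p q → p ≡ 1ℤ * p + 1ℤ * q + - q
  lemma = solve-∀

-- Word-indexed families of power series

WordPS : Set
WordPS = Word → PS

infixl 7 _⊛_

-- The product of noncommutative series with power series as coefficients: the sum runs over all
-- factorizations of the word into a left and a right piece, either of which may be empty.
_⊛_ : WordPS → WordPS → WordPS
(F ⊛ X) []      m = (F [] ⋆ X []) m
(F ⊛ X) (c ∷ a) m = (F [] ⋆ X (c ∷ a)) m + ((F ∘ (c ∷_)) ⊛ X) a m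

⊛-cong : ∀ {F G X Y : WordPS} → (∀ a → F a ≗ G a) → (∀ a → X a ≗ Y a) → ∀ a → (F ⊛ X) a ≗ (G ⊛ Y) a
⊛-cong e e′ []      m = ⋆-cong (e []) (e′ []) m
⊛-cong e e′ (c ∷ a) m = cong₂ _+_ (⋆-cong (e []) (e′ (c ∷ a)) m) (⊛-cong (e ∘ (c ∷_)) e′ a m)

⊛-linearˡ : ∀ x y F G X a m →
  ((λ b n → x * F b n + y * G b n) ⊛ X) a m ≡ x * (F ⊛ X) a m + y * (G ⊛ X) a m
⊛-linearˡ x y F G X []      m = ⋆-linearˡ x y (F []) (G []) (X []) m
⊛-linearˡ x y F G X (c ∷ a) m =
  trans (cong₂ _+_ (⋆-linearˡ x y (F []) (G []) (X (c ∷ a)) m)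
                   (⊛-linearˡ x y (F ∘ (c ∷_)) (G ∘ (c ∷_)) X a m))
        (lemma x y _ _ _ _)
  where
  lemma : ∀ x y p q r s → x * p + y * q + (x * r + y * s) ≡ x * (p + r) + y * (q + s)
  lemma = solve-∀

⊛-zeroˡ : ∀ {F} X → (∀ a m → F a m ≡ 0ℤ) → ∀ a m → (F ⊛ X) a m ≡ 0ℤ
⊛-zeroˡ X e []      m = ⋆-zeroˡ (X []) (e []) m
⊛-zeroˡ X e (c ∷ a) m = cong₂ _+_ (⋆-zeroˡ (X (c ∷ a)) (e []) m) (⊛-zeroˡ X (e ∘ (c ∷_)) a m)

⊛-lin : ∀ x κ F X a m →
  ((λ b n → lin x κ (λ c → F c n) b) ⊛ X) a m ≡ lin x κ (λ c → (F ⊛ X) c m) a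
⊛-lin x κ F X []      m = ⋆-scaleˡ x (F []) (X []) m
⊛-lin x κ F X (c ∷ a) m =
  trans (cong₂ _+_ (⋆-scaleˡ x (F []) (X (c ∷ a)) m) (⊛-linearˡ x (κ c) (F ∘ (c ∷_)) F X a m))
        (lemma x (κ c) _ _ _)
  where
  lemma : ∀ x k p q r → x * p + (x * q + k * r) ≡ x * (p + q) + k * r
  lemma = solve-∀

⊛-identityˡ : ∀ X a m → ((λ b n → one b * onePS n) ⊛ X) a m ≡ X a m
⊛-identityˡ X a m = helper a
  where
  unit : ∀ f → ((λ n → 1ℤ * onePS n) ⋆ f) m ≡ f m
  unit f = trans (⋆-scaleˡ 1ℤ onePS f m) (trans (ℤₚ.*-identityˡ _) (⋆-identityˡ f m))

  helper : ∀ a → ((λ b n → one b * onePS n) ⊛ X) a m ≡ X a m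
  helper []      = unit (X [])
  helper (c ∷ a) =
    trans (cong₂ _+_ (unit (X (c ∷ a))) (⊛-zeroˡ X (λ _ n → ℤₚ.*-zeroˡ (onePS n)) a m))
          (ℤₚ.+-identityʳ _)

⊛-peel : ∀ F X a k m →
  (F ⊛ X) a (k ∷ m) ≡ ∑< (suc k) (λ i → ((λ b n → F b (i ∷ n)) ⊛ (λ b n → X b ((k ∸ i) ∷ n))) a m)
⊛-peel F X []      k m = ⋆-peel (F []) (X []) k m
⊛-peel F X (c ∷ a) k m =
  trans (cong₂ _+_ (⋆-peel (F []) (X (c ∷ a)) k m) (⊛-peel (F ∘ (c ∷_)) X a k m))
        (sym (∑<-+ (suc k)
          (λ i → ((F [] ∘ (i ∷_)) ⋆ (X (c ∷ a) ∘ ((k ∸ i) ∷_))) m)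
          (λ i → ((λ b n → F (c ∷ b) (i ∷ n)) ⊛ (λ b n → X b ((k ∸ i) ∷ n))) a m)))

-- Convolution inverse of the multi-fundamental quasisymmetric functions

-- ℒ m (aWord β) is the coefficient of m in L̃_β. The boxes whose set contains the first variable
-- form an initial row, and only the last of these sets may contain further variables.

ℒ : Monomial → Series
ℒ []          = const 0ℤ
ℒ (zero ∷ m)  = ℒ m
ℒ (suc k ∷ m) = fold (λ a → one a * onePS m + 𝐄 (ℒ m) a) (prefix h) k

t : ℕ → Series → Series
t zero    Y = Y
t (suc k) Y = −𝐄 (fold Y (−1+ v) k)

-- The factor of the first variable acts first and stays next to `Y`, to the right of all the
-- others: the order of an inverse.
𝒯 : Monomial → Series → Series
𝒯 []      Y = Y
𝒯 (k ∷ m) Y = 𝒯 m (t k Y)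

-- The right-hand side is a general `Y`, constant in the variables, because extracting the first
-- variable in degree k leaves the same equation with `t k Y` in place of `Y`. Thus the induction
-- closes.
module Peel (X : WordPS) (Y : Series)
  (hyp : ∀ a m → X a m + 𝐄 (λ b → ((λ c n → ℒ n c) ⊛ X) b m) a ≡ Y a * onePS m) where

  Xₖ : ℕ → WordPS
  Xₖ k a m = X a (k ∷ m)

  -- Z k = (1 + E L) Xₖ k for the remaining variables. The first-variable degree-k part of (1 + E L) X
  -- is Z k + E W k.
  Z W : ℕ → WordPS
  Z k a m = Xₖ k a m + 𝐄 (λ b → ((λ c n → ℒ n c) ⊛ Xₖ k) b m) a
  W k a m = ∑< k (λ i → ((λ c n → ℒ (suc i ∷ n) c) ⊛ Xₖ (k ∸ suc i)) a m)

  Z-W : ∀ k a m → Z k a m + 𝐄 (λ b → W k b m) a ≡ Y a * onePS (k ∷ m)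
  Z-W k a m = begin
    Z k a m + 𝐄 (λ b → W k b m) a
      ≡⟨ ℤₚ.+-assoc (Xₖ k a m) _ _ ⟩
    Xₖ k a m + (𝐄 (λ b → ((λ c n → ℒ n c) ⊛ Xₖ k) b m) a + 𝐄 (λ b → W k b m) a)
      ≡⟨ cong (λ z → Xₖ k a m + z) (lin-+ 1ℤ (const 1ℤ) _ _ a) ⟨
    Xₖ k a m + 𝐄 (λ b → ((λ c n → ℒ n c) ⊛ Xₖ k) b m + W k b m) a
      -- The summand i = 0 of `⊛-peel` is the one inside `Z k`, since `ℒ (0 ∷ n)` is `ℒ n`; the
      -- remaining summands are `W k`.
      ≡⟨ cong (λ z → Xₖ k a m + z) (lin-cong 1ℤ (const 1ℤ) (λ b → ⊛-peel (λ c n → ℒ n c) X b k m) a) ⟨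
    X a (k ∷ m) + 𝐄 (λ b → ((λ c n → ℒ n c) ⊛ X) b (k ∷ m)) a
      ≡⟨ hyp a (k ∷ m) ⟩
    Y a * onePS (k ∷ m) ∎

  -- In degree 1 of the first variable `ℒ` is 1 + E L for the remaining variables, which yields
  -- `Z k`; each further degree prepends h, which yields h times the previous sum.
  W-suc : ∀ k a m → W (suc k) a m ≡ Z k a m + prefix h (λ b → W k b m) a
  W-suc k a m = cong₂ _+_ first (rest k (λ i → i))
    where
    first : ((λ c n → ℒ (1 ∷ n) c) ⊛ Xₖ k) a m ≡ Z k a m
    first = begin
      ((λ c n → one c * onePS n + 𝐄 (ℒ n) c) ⊛ Xₖ k) a m
        ≡⟨ ⊛-cong {X = Xₖ k} (λ b n → sym (lemma (one b * onePS n) (𝐄 (ℒ n) b))) (λ _ _ → refl) a m ⟩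
      ((λ c n → 1ℤ * (one c * onePS n) + 1ℤ * 𝐄 (ℒ n) c) ⊛ Xₖ k) a m
        ≡⟨ ⊛-linearˡ 1ℤ 1ℤ (λ c n → one c * onePS n) (λ c n → 𝐄 (ℒ n) c) (Xₖ k) a m ⟩
      1ℤ * ((λ c n → one c * onePS n) ⊛ Xₖ k) a m + 1ℤ * ((λ c n → 𝐄 (ℒ n) c) ⊛ Xₖ k) a m
        ≡⟨ lemma (((λ c n → one c * onePS n) ⊛ Xₖ k) a m) (((λ c n → 𝐄 (ℒ n) c) ⊛ Xₖ k) a m) ⟩
      ((λ c n → one c * onePS n) ⊛ Xₖ k) a m + ((λ c n → 𝐄 (ℒ n) c) ⊛ Xₖ k) a m
        ≡⟨ cong₂ _+_ (⊛-identityˡ (Xₖ k) a m) (⊛-lin 1ℤ (const 1ℤ) (λ c n → ℒ n c) (Xₖ k) a m) ⟩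
      Z k a m ∎
      where
      lemma : ∀ p q → 1ℤ * p + 1ℤ * q ≡ p + q
      lemma = solve-∀

    rest : ∀ j (g : ℕ → ℕ) →
      ∑< j (λ i → ((λ c n → ℒ (suc (suc (g i)) ∷ n) c) ⊛ Xₖ (suc k ∸ suc (suc (g i)))) a m) ≡
      prefix h (λ b → ∑< j (λ i → ((λ c n → ℒ (suc (g i) ∷ n) c) ⊛ Xₖ (k ∸ suc (g i))) b m)) a
    rest zero    g = sym (lin-zero 0ℤ (δ h) (λ _ → refl) a)
    rest (suc j) g =
      trans (cong₂ _+_ (⊛-lin 0ℤ (δ h) (λ c n → ℒ (suc (g 0) ∷ n) c) (Xₖ (k ∸ suc (g 0))) a m)
                       (rest j (g ∘ suc)))
            (sym (lin-+ 0ℤ (δ h) _ _ a))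

  Z-zero : ∀ a m → Z 0 a m ≡ Y a * onePS m
  Z-zero a m = begin
    Z 0 a m
      ≡⟨ ℤₚ.+-identityʳ _ ⟨
    Z 0 a m + 0ℤ
      ≡⟨ cong (λ z → Z 0 a m + z) (lin-zero 1ℤ (const 1ℤ) (λ _ → refl) a) ⟨
    Z 0 a m + 𝐄 (λ b → W 0 b m) a
      ≡⟨ Z-W 0 a m ⟩
    Y a * onePS m ∎

  Z-suc : ∀ k a m → Z (suc k) a m ≡ −𝐄 (λ b → W (suc k) b m) a
  Z-suc k a m = begin
    Z (suc k) a m
      ≡⟨ lemma (Z (suc k) a m) (𝐄 (λ b → W (suc k) b m) a) ⟩
    Z (suc k) a m + 𝐄 (λ b → W (suc k) b m) a + - 𝐄 (λ b → W (suc k) b m) a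
      ≡⟨ cong (λ z → z + - 𝐄 (λ b → W (suc k) b m) a) (trans (Z-W (suc k) a m) (ℤₚ.*-zeroʳ (Y a))) ⟩
    0ℤ + - 𝐄 (λ b → W (suc k) b m) a
      ≡⟨ negate a ⟩
    −𝐄 (λ b → W (suc k) b m) a ∎
    where
    lemma : ∀ p q → p ≡ p + q + - q
    lemma = solve-∀
    lemma₁ : ∀ p → 0ℤ + - (1ℤ * p) ≡ -1ℤ * p
    lemma₁ = solve-∀
    lemma₂ : ∀ p q → 0ℤ + - (1ℤ * p + 1ℤ * q) ≡ -1ℤ * p + -1ℤ * q
    lemma₂ = solve-∀
    negate : ∀ {F} a → 0ℤ + - 𝐄 F a ≡ −𝐄 F a
    negate {F} []      = lemma₁ (F [])
    negate {F} (c ∷ a) = lemma₂ (F (c ∷ a)) (F a)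

  -- Inserting `Z-suc` into `W-suc` multiplies by -E + h = -(1 + v) at each step.
  W-fold : ∀ k a m → W (suc k) a m ≡ fold Y (−1+ v) k a * onePS m
  W-fold zero a m = begin
    W 1 a m
      ≡⟨ W-suc 0 a m ⟩
    Z 0 a m + prefix h (λ b → W 0 b m) a
      ≡⟨ cong₂ _+_ (Z-zero a m) (lin-zero 0ℤ (δ h) (λ _ → refl) a) ⟩
    Y a * onePS m + 0ℤ
      ≡⟨ ℤₚ.+-identityʳ _ ⟩
    Y a * onePS m ∎
  W-fold (suc k) a m = begin
    W (suc (suc k)) a m
      ≡⟨ W-suc (suc k) a m ⟩
    Z (suc k) a m + prefix h (λ b → W (suc k) b m) a
      ≡⟨ cong (λ z → z + prefix h (λ b → W (suc k) b m) a) (Z-suc k a m) ⟩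
    −𝐄 (λ b → W (suc k) b m) a + prefix h (λ b → W (suc k) b m) a
      ≡⟨ combine a ⟩
    −1+ v (λ b → W (suc k) b m) a
      ≡⟨ lin-cong -1ℤ _ (λ b → W-fold k b m) a ⟩
    −1+ v (λ b → fold Y (−1+ v) k b * onePS m) a
      ≡⟨ lin-scaleʳ -1ℤ _ (fold Y (−1+ v) k) (onePS m) a ⟩
    fold Y (−1+ v) (suc k) a * onePS m ∎
    where
    lemma₁ : ∀ p → -1ℤ * p + 0ℤ * p ≡ -1ℤ * p
    lemma₁ = solve-∀
    lemma₂ : ∀ p q → -1ℤ * p + -1ℤ * q + (0ℤ * p + 1ℤ * q) ≡ -1ℤ * p + - 0ℤ * q
    lemma₂ = solve-∀
    lemma₃ : ∀ p q → -1ℤ * p + -1ℤ * q + (0ℤ * p + 0ℤ * q) ≡ -1ℤ * p + - 1ℤ * q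
    lemma₃ = solve-∀
    combine : ∀ {F} a → −𝐄 F a + prefix h F a ≡ −1+ v F a
    combine {F} []      = lemma₁ (F [])
    combine {F} (h ∷ a) = lemma₂ (F (h ∷ a)) (F a)
    combine {F} (v ∷ a) = lemma₃ (F (v ∷ a)) (F a)

  Z-t : ∀ k a m → Z k a m ≡ t k Y a * onePS m
  Z-t zero    = Z-zero
  Z-t (suc k) a m =
    trans (Z-suc k a m)
    (trans (lin-cong -1ℤ _ (λ b → W-fold k b m) a) (lin-scaleʳ -1ℤ _ (fold Y (−1+ v) k) (onePS m) a))

-- `Peel` removes one variable at a time. When none is left, `ℒ []` is zero and the equation itself
-- reads X = Y.
convolution-inverse : ∀ X Y →
  (∀ a m → X a m + 𝐄 (λ b → ((λ c n → ℒ n c) ⊛ X) b m) a ≡ Y a * onePS m) →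
  ∀ m a → X a m ≡ 𝒯 m Y a
convolution-inverse X Y hyp [] a = begin
  X a []
    ≡⟨ ℤₚ.+-identityʳ _ ⟨
  X a [] + 0ℤ
    ≡⟨ cong (λ z → X a [] + z) (lin-zero 1ℤ (const 1ℤ) (constant (λ c n → ℒ n c) (λ _ → refl)) a) ⟨
  X a [] + 𝐄 (λ b → ((λ c n → ℒ n c) ⊛ X) b []) a
    ≡⟨ hyp a [] ⟩
  Y a * 1ℤ
    ≡⟨ ℤₚ.*-identityʳ (Y a) ⟩
  Y a ∎
  where
  constant : ∀ F → (∀ b → F b [] ≡ 0ℤ) → ∀ b → (F ⊛ X) b [] ≡ 0ℤ
  constant F e []      = trans (ℤₚ.+-identityʳ _) (cong (_* X [] []) (e []))
  constant F e (c ∷ b) =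
    cong₂ _+_ (trans (ℤₚ.+-identityʳ _) (cong (_* X (c ∷ b) []) (e [])))
              (constant (F ∘ (c ∷_)) (e ∘ (c ∷_)) b)
convolution-inverse X Y hyp (k ∷ m) a = convolution-inverse (Xₖ k) (t k Y) (Z-t k) m a
  where open Peel X Y hyp

-- The inverse by right multiplications

fold-lin-cong : ∀ x κ {F G} → F ≗ G → ∀ k → fold F (lin x κ) k ≗ fold G (lin x κ) k
fold-lin-cong x κ e zero    = e
fold-lin-cong x κ e (suc k) = lin-cong x κ (fold-lin-cong x κ e k)

fold-linʳ-cong : ∀ x κ {F G} → F ≗ G → ∀ k → fold F (linʳ x κ) k ≗ fold G (linʳ x κ) k
fold-linʳ-cong x κ e zero    = e
fold-linʳ-cong x κ e (suc k) = linʳ-cong x κ (fold-linʳ-cong x κ e k)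

fold-lin-linʳ-comm : ∀ x κ y μ F k → fold (linʳ y μ F) (lin x κ) k ≗ linʳ y μ (fold F (lin x κ) k)
fold-lin-linʳ-comm x κ y μ F zero    a = refl
fold-lin-linʳ-comm x κ y μ F (suc k) a =
  trans (lin-cong x κ (fold-lin-linʳ-comm x κ y μ F k) a) (lin-linʳ-comm x κ y μ _ a)

lin-fold-linʳ-comm : ∀ x κ y μ F k → lin x κ (fold F (linʳ y μ) k) ≗ fold (lin x κ F) (linʳ y μ) k
lin-fold-linʳ-comm x κ y μ F zero    a = refl
lin-fold-linʳ-comm x κ y μ F (suc k) a =
  trans (lin-linʳ-comm x κ y μ _ a) (linʳ-cong y μ (lin-fold-linʳ-comm x κ y μ F k) a)

fold-shift : {A : Set} (z : A) (s : A → A) (k : ℕ) → fold (s z) s k ≡ s (fold z s k)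
fold-shift z s zero    = refl
fold-shift z s (suc k) = cong s (fold-shift z s k)

fold-lin-one : ∀ x κ k → fold one (lin x κ) k ≗ fold one (linʳ x κ) k
fold-lin-one x κ zero    a = refl
fold-lin-one x κ (suc k) a = begin
  fold one (lin x κ) (suc k) a           ≡⟨ cong (λ F → F a) (fold-shift one (lin x κ) k) ⟨
  fold (lin x κ one) (lin x κ) k a       ≡⟨ fold-lin-cong x κ (lin-one x κ) k a ⟩
  fold (linʳ x κ one) (lin x κ) k a      ≡⟨ fold-lin-linʳ-comm x κ x κ one k a ⟩
  linʳ x κ (fold one (lin x κ) k) a      ≡⟨ linʳ-cong x κ (fold-lin-one x κ k) a ⟩
  fold one (linʳ x κ) (suc k) a          ∎

-- t and tʳ are left and right multiplication by the coefficient of xᵏ in 1 − x E (1 + x (1 + v))⁻¹.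

tʳ : ℕ → Series → Series
tʳ zero    Y = Y
tʳ (suc k) Y = fold (−𝐄ʳ Y) (−1+ʳ v) k

t-one : ∀ k → t k one ≗ tʳ k one
t-one zero    a = refl
t-one (suc k) a =
  trans (lin-cong -1ℤ _ (fold-lin-one -1ℤ _ k) a)
  (trans (lin-fold-linʳ-comm -1ℤ _ -1ℤ _ one k a) (fold-linʳ-cong -1ℤ _ (lin-one -1ℤ (const -1ℤ)) k a))

t-cong : ∀ k {F G} → F ≗ G → t k F ≗ t k G
t-cong zero    e = e
t-cong (suc k) e = lin-cong -1ℤ _ (fold-lin-cong -1ℤ _ e k)

tʳ-cong : ∀ k {F G} → F ≗ G → tʳ k F ≗ tʳ k G
tʳ-cong zero    e = e
tʳ-cong (suc k) e = fold-linʳ-cong -1ℤ _ (linʳ-cong -1ℤ _ e) k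

𝒯-cong : ∀ m {F G} → F ≗ G → 𝒯 m F ≗ 𝒯 m G
𝒯-cong []      e = e
𝒯-cong (k ∷ m) e = 𝒯-cong m (t-cong k e)

t-linʳ : ∀ k y μ F → t k (linʳ y μ F) ≗ linʳ y μ (t k F)
t-linʳ zero    y μ F a = refl
t-linʳ (suc k) y μ F a =
  trans (lin-cong -1ℤ _ (fold-lin-linʳ-comm -1ℤ _ y μ F k) a) (lin-linʳ-comm -1ℤ _ y μ _ a)

𝒯-linʳ : ∀ m y μ F → 𝒯 m (linʳ y μ F) ≗ linʳ y μ (𝒯 m F)
𝒯-linʳ []      y μ F a = refl
𝒯-linʳ (k ∷ m) y μ F a = trans (𝒯-cong m (t-linʳ k y μ F) a) (𝒯-linʳ m y μ (t k F) a)

𝒯-tʳ : ∀ m k F → 𝒯 m (tʳ k F) ≗ tʳ k (𝒯 m F)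
𝒯-tʳ m zero          F a = refl
𝒯-tʳ m (suc zero)    F a = 𝒯-linʳ m -1ℤ (const -1ℤ) F a
𝒯-tʳ m (suc (suc k)) F a =
  trans (𝒯-linʳ m -1ℤ _ _ a) (linʳ-cong -1ℤ _ (𝒯-tʳ m (suc k) F) a)

-- Acting on the unit, the innermost factor can be moved to the right-hand side, where it commutes
-- with the left multiplications of the later variables. The first variable thereby becomes
-- outermost, as it is in the recursion for `Pᵗ`.
𝒯-one : ∀ k m → 𝒯 (k ∷ m) one ≗ tʳ k (𝒯 m one)
𝒯-one k m a = trans (𝒯-cong m (t-one k) a) (𝒯-tʳ m k one a)

-- Mergings

-- The product of the factors 1 + d over the letters d of the word; its coefficients count the
-- deletions that leave a given word.
sub : Word → Series
sub []      = one
sub (d ∷ b) = lin 1ℤ (δ d) (sub b)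

-- The order is that of `subsetsOf`, with h for a missing position and v for a chosen one, so that
-- `subsetsOf-interval` is an equality of lists.
words : ℕ → List Word
words zero    = [] ∷ []
words (suc n) = map (h ∷_) (words n) ++ map (v ∷_) (words n)

-- Φ n is the part of the merging sum over the ribbons with n + 1 boxes; deleting or keeping each
-- letter c of such a ribbon accounts for a factor 1 + c.

Φ : ℕ → Series → Series
Φ zero    F a = -1ℤ * F [] * one a
Φ (suc n) F a = −1+ h (Φ n (F ∘ (h ∷_))) a + −1+ v (Φ n (F ∘ (v ∷_))) a

Φ-words : ∀ n F a → Φ n F a ≡ ∑ (words n) (λ b → sgn (suc n) * sub b a * F b)
Φ-words zero F a = lemma (F []) (one a)
  where
  lemma : ∀ p q → -1ℤ * p * q ≡ -1ℤ * q * p + 0ℤ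
  lemma = solve-∀
Φ-words (suc n) F a = begin
  −1+ h (Φ n (F ∘ (h ∷_))) a + −1+ v (Φ n (F ∘ (v ∷_))) a
    ≡⟨ cong₂ _+_ (branch h a) (branch v a) ⟩
  ∑ (words n) (f ∘ (h ∷_)) + ∑ (words n) (f ∘ (v ∷_))
    ≡⟨ cong₂ _+_ (∑-map (h ∷_) f (words n)) (∑-map (v ∷_) f (words n)) ⟨
  ∑ (map (h ∷_) (words n)) f + ∑ (map (v ∷_) (words n)) f
    ≡⟨ ∑-++ f (map (h ∷_) (words n)) (map (v ∷_) (words n)) ⟨
  ∑ (words (suc n)) f ∎
  where
  f : Word → ℤ
  f b = sgn (suc (suc n)) * sub b a * F b

  lemma₁ : ∀ p → -1ℤ * p ≡ -1ℤ * p + 0ℤ * p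
  lemma₁ = solve-∀
  lemma₂ : ∀ s p q → -1ℤ * (s * p * q) + 0ℤ * (s * p * q) ≡ -1ℤ * s * (1ℤ * p) * q
  lemma₂ = solve-∀
  lemma₃ : ∀ s p q k r → -1ℤ * (s * p * q) + - k * (s * r * q) ≡ -1ℤ * s * (1ℤ * p + k * r) * q
  lemma₃ = solve-∀

  branch : ∀ c a → −1+ c (Φ n (F ∘ (c ∷_))) a ≡
    ∑ (words n) (λ b → sgn (suc (suc n)) * lin 1ℤ (δ c) (sub b) a * F (c ∷ b))
  branch c [] = begin
    -1ℤ * Φ n (F ∘ (c ∷_)) []
      ≡⟨ cong (-1ℤ *_) (Φ-words n (F ∘ (c ∷_)) []) ⟩
    -1ℤ * ∑ (words n) g
      ≡⟨ lemma₁ (∑ (words n) g) ⟩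
    -1ℤ * ∑ (words n) g + 0ℤ * ∑ (words n) g
      ≡⟨ ∑-linear (words n) -1ℤ 0ℤ g g ⟨
    ∑ (words n) (λ b → -1ℤ * g b + 0ℤ * g b)
      ≡⟨ ∑-cong (words n) (λ b → lemma₂ (sgn (suc n)) (sub b []) (F (c ∷ b))) ⟩
    ∑ (words n) (λ b → sgn (suc (suc n)) * lin 1ℤ (δ c) (sub b) [] * F (c ∷ b)) ∎
    where
    g : Word → ℤ
    g b = sgn (suc n) * sub b [] * F (c ∷ b)
  branch c (d ∷ a) = begin
    −1+ c (Φ n (F ∘ (c ∷_))) (d ∷ a)
      ≡⟨ lin-cong -1ℤ (λ d → - δ c d) (Φ-words n (F ∘ (c ∷_))) (d ∷ a) ⟩
    -1ℤ * ∑ (words n) (g (d ∷ a)) + - δ c d * ∑ (words n) (g a)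
      ≡⟨ ∑-linear (words n) -1ℤ (- δ c d) (g (d ∷ a)) (g a) ⟨
    ∑ (words n) (λ b → -1ℤ * g (d ∷ a) b + - δ c d * g a b)
      ≡⟨ ∑-cong (words n) (λ b → lemma₃ (sgn (suc n)) (sub b (d ∷ a)) (F (c ∷ b)) (δ c d) (sub b a)) ⟩
    ∑ (words n) (λ b → sgn (suc (suc n)) * lin 1ℤ (δ c) (sub b) (d ∷ a) * F (c ∷ b)) ∎
    where
    g : Word → Word → ℤ
    g a b = sgn (suc n) * sub b a * F (c ∷ b)

Φ-cong : ∀ n {F G} → F ≗ G → Φ n F ≗ Φ n G
Φ-cong zero    e a = cong (λ z → -1ℤ * z * one a) (e [])
Φ-cong (suc n) e a = cong₂ _+_ (lin-cong -1ℤ _ (Φ-cong n (e ∘ (h ∷_))) a)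
                               (lin-cong -1ℤ _ (Φ-cong n (e ∘ (v ∷_))) a)

Φ-+ : ∀ n F G a → Φ n (λ b → F b + G b) a ≡ Φ n F a + Φ n G a
Φ-+ zero F G a = lemma (F []) (G []) (one a)
  where
  lemma : ∀ p q r → -1ℤ * (p + q) * r ≡ -1ℤ * p * r + -1ℤ * q * r
  lemma = solve-∀
Φ-+ (suc n) F G a =
  trans (cong₂ _+_ (branch h) (branch v))
        (lemma (−1+ h (Φ n (F ∘ (h ∷_))) a) _ _ _)
  where
  lemma : ∀ p q r s → p + q + (r + s) ≡ p + r + (q + s)
  lemma = solve-∀
  branch : ∀ c → −1+ c (Φ n (λ b → F (c ∷ b) + G (c ∷ b))) a
               ≡ −1+ c (Φ n (F ∘ (c ∷_))) a + −1+ c (Φ n (G ∘ (c ∷_))) a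
  branch c = trans (lin-cong -1ℤ _ (Φ-+ n (F ∘ (c ∷_)) (G ∘ (c ∷_))) a) (lin-+ -1ℤ _ _ _ a)

Φ-zero : ∀ n {F} → (∀ b → length b ≡ n → F b ≡ 0ℤ) → ∀ a → Φ n F a ≡ 0ℤ
Φ-zero zero    e a = cong (λ z → -1ℤ * z * one a) (e [] refl)
Φ-zero (suc n) e a = cong₂ _+_ (lin-zero -1ℤ _ (Φ-zero n (λ b p → e (h ∷ b) (cong suc p))) a)
                               (lin-zero -1ℤ _ (Φ-zero n (λ b p → e (v ∷ b) (cong suc p))) a)

-- The ribbons with at most d boxes, that is, the words of length less than d.
Φ< : ℕ → Series → Series
Φ< d F a = ∑< d (λ n → Φ n F a)

lin-∑< : ∀ x κ d (G : ℕ → Series) a →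
  lin x κ (λ b → ∑< d (λ n → G n b)) a ≡ ∑< d (λ n → lin x κ (G n) a)
lin-∑< x κ zero    G a = lin-zero x κ (λ _ → refl) a
lin-∑< x κ (suc d) G a =
  trans (lin-+ x κ (G 0) _ a) (cong (λ z → lin x κ (G 0) a + z) (lin-∑< x κ d (G ∘ suc) a))

Φ<-prefix : ∀ d F a → Φ< (suc d) (prefix h F) a ≡ −1+ h (Φ< d F) a
Φ<-prefix d F a = begin
  -1ℤ * (0ℤ * F []) * one a + ∑< d (λ n → Φ (suc n) (prefix h F) a)
    ≡⟨ cong₂ _+_ (lemma₁ (F []) (one a)) (∑<-cong d step) ⟩
  0ℤ + ∑< d (λ n → −1+ h (Φ n F) a)
    ≡⟨ ℤₚ.+-identityˡ _ ⟩
  ∑< d (λ n → −1+ h (Φ n F) a)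
    ≡⟨ lin-∑< -1ℤ _ d (λ n → Φ n F) a ⟨
  −1+ h (Φ< d F) a ∎
  where
  lemma₁ : ∀ p q → -1ℤ * (0ℤ * p) * q ≡ 0ℤ
  lemma₁ = solve-∀
  lemma₂ : ∀ p q → 0ℤ * p + 1ℤ * q ≡ q
  lemma₂ = solve-∀
  lemma₃ : ∀ p q → 0ℤ * p + 0ℤ * q ≡ 0ℤ
  lemma₃ = solve-∀
  step : ∀ n → Φ (suc n) (prefix h F) a ≡ −1+ h (Φ n F) a
  step n = trans
    (cong₂ _+_
      (lin-cong -1ℤ _ (Φ-cong n (λ b → lemma₂ (F (h ∷ b)) (F b))) a)
      (lin-zero -1ℤ _ (Φ-zero n (λ b _ → lemma₃ (F (v ∷ b)) (F b))) a))
    (ℤₚ.+-identityʳ _)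

-- The substitution turns E into -E. The letters of E lengthen words by one while its term 1 does
-- not, so the truncations agree only if F contributes nothing at length d; this is the hypothesis
-- on `Φ d F`.
Φ<-𝐄 : ∀ d s F → (∀ a → Φ d F a ≡ 0ℤ) → ∀ a →
  Φ< (suc d) (λ b → one b * s + 𝐄 F b) a ≡ -1ℤ * (one a * s + 𝐄 (Φ< d F) a)
Φ<-𝐄 d s F e a = begin
  -1ℤ * (1ℤ * s + 1ℤ * F []) * one a + ∑< d (λ n → Φ (suc n) B a)
    ≡⟨ cong₂ _+_ (lemma₁ s (F []) (one a)) (trans (∑<-cong d step) (∑<-+ d (λ n → Φ (suc n) F a) r)) ⟩
  -1ℤ * (one a * s) + Φ 0 F a + (∑< d (λ n → Φ (suc n) F a) + ∑< d r)
    ≡⟨ lemma₂ (-1ℤ * (one a * s)) (Φ 0 F a) (∑< d (λ n → Φ (suc n) F a)) (∑< d r) ⟩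
  -1ℤ * (one a * s) + (Φ< (suc d) F a + ∑< d r)
    ≡⟨ cong (λ z → -1ℤ * (one a * s) + z) (cong₂ _+_ last sum-r) ⟩
  -1ℤ * (one a * s) + (Φ< d F a + (−1+ h (Φ< d F) a + −1+ v (Φ< d F) a))
    ≡⟨ cong (λ z → -1ℤ * (one a * s) + z) (combine a) ⟩
  -1ℤ * (one a * s) + -1ℤ * 𝐄 (Φ< d F) a
    ≡⟨ ℤₚ.*-distribˡ-+ -1ℤ (one a * s) (𝐄 (Φ< d F) a) ⟨
  -1ℤ * (one a * s + 𝐄 (Φ< d F) a) ∎
  where
  B : Series
  B b = one b * s + 𝐄 F b

  r : ℕ → ℤ
  r n = −1+ h (Φ n F) a + −1+ v (Φ n F) a

  lemma₁ : ∀ s p q → -1ℤ * (1ℤ * s + 1ℤ * p) * q ≡ -1ℤ * (q * s) + -1ℤ * p * q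
  lemma₁ = solve-∀
  lemma₂ : ∀ p q r s → p + q + (r + s) ≡ p + (q + r + s)
  lemma₂ = solve-∀
  lemma₃ : ∀ s p q → 0ℤ * s + (1ℤ * p + 1ℤ * q) ≡ p + q
  lemma₃ = solve-∀
  lemma₄ : ∀ p q r s → p + q + (r + s) ≡ p + r + (q + s)
  lemma₄ = solve-∀

  branch : ∀ c n → −1+ c (Φ n (B ∘ (c ∷_))) a ≡ −1+ c (Φ n (F ∘ (c ∷_))) a + −1+ c (Φ n F) a
  branch c n = trans
    (lin-cong -1ℤ _ (λ b → trans (Φ-cong n (λ b → lemma₃ s (F (c ∷ b)) (F b)) b)
                                 (Φ-+ n (F ∘ (c ∷_)) F b)) a)
    (lin-+ -1ℤ _ _ _ a)

  step : ∀ n → Φ (suc n) B a ≡ Φ (suc n) F a + r n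
  step n = trans (cong₂ _+_ (branch h n) (branch v n))
    (lemma₄ (−1+ h (Φ n (F ∘ (h ∷_))) a) (−1+ h (Φ n F) a)
            (−1+ v (Φ n (F ∘ (v ∷_))) a) (−1+ v (Φ n F) a))

  last : Φ< (suc d) F a ≡ Φ< d F a
  last = trans (∑<-last d (λ n → Φ n F a))
    (trans (cong (λ z → Φ< d F a + z) (e a)) (ℤₚ.+-identityʳ _))

  sum-r : ∑< d r ≡ −1+ h (Φ< d F) a + −1+ v (Φ< d F) a
  sum-r = trans (∑<-+ d (λ n → −1+ h (Φ n F) a) (λ n → −1+ v (Φ n F) a))
    (sym (cong₂ _+_ (lin-∑< -1ℤ _ d (λ n → Φ n F) a) (lin-∑< -1ℤ _ d (λ n → Φ n F) a)))

  lemma₅ : ∀ p → p + (-1ℤ * p + -1ℤ * p) ≡ -1ℤ * (1ℤ * p)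
  lemma₅ = solve-∀
  lemma₆ : ∀ p q → p + (-1ℤ * p + - 1ℤ * q + (-1ℤ * p + - 0ℤ * q)) ≡ -1ℤ * (1ℤ * p + 1ℤ * q)
  lemma₆ = solve-∀
  lemma₇ : ∀ p q → p + (-1ℤ * p + - 0ℤ * q + (-1ℤ * p + - 1ℤ * q)) ≡ -1ℤ * (1ℤ * p + 1ℤ * q)
  lemma₇ = solve-∀

  combine : ∀ {G : Series} a → G a + (−1+ h G a + −1+ v G a) ≡ -1ℤ * 𝐄 G a
  combine {G} []      = lemma₅ (G [])
  combine {G} (h ∷ a) = lemma₆ (G (h ∷ a)) (G a)
  combine {G} (v ∷ a) = lemma₇ (G (v ∷ a)) (G a)

-- Each of the `length b + 1` boxes holds at least one value, so the monomial has at least that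
-- degree.
ℒ-support : ∀ m b → degree m ℕ.≤ length b → ℒ m b ≡ 0ℤ
ℒ-support []          b       _ = refl
ℒ-support (zero ∷ m)  b       p = ℒ-support m b p
ℒ-support (suc k ∷ m) b       p = row k b p
  where
  lemma₁ : ∀ p → 0ℤ * p + 0ℤ * p ≡ 0ℤ
  lemma₁ = solve-∀
  lemma₂ : ∀ p q → 0ℤ * p + 0ℤ * q ≡ 0ℤ
  lemma₂ = solve-∀

  B : Series
  B a = one a * onePS m + 𝐄 (ℒ m) a

  row : ∀ k b → suc (k ℕ.+ degree m) ℕ.≤ length b → fold B (prefix h) k b ≡ 0ℤ
  row zero (c ∷ b) (ℕ.s≤s p) =
    trans (cong₂ (λ x y → 0ℤ * onePS m + (1ℤ * x + 1ℤ * y))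
                 (ℒ-support m (c ∷ b) (ℕₚ.m≤n⇒m≤1+n p)) (ℒ-support m b p))
          (trans (ℤₚ.+-identityʳ _) (ℤₚ.*-zeroˡ (onePS m)))
  row (suc k) (h ∷ b) (ℕ.s≤s p) =
    trans (cong (λ z → 0ℤ * fold B (prefix h) k (h ∷ b) + 1ℤ * z) (row k b p))
          (lemma₂ (fold B (prefix h) k (h ∷ b)) 0ℤ)
  row (suc k) (v ∷ b) p = lemma₂ (fold B (prefix h) k (v ∷ b)) (fold B (prefix h) k b)

-- The coefficient of m in the signed merging sum, as a function of the word of the target ribbon
-- and with the same cut-off as `ΣL`.
P : Monomial → Series
P m = Φ< (degree m) (ℒ m)

P-suc : ∀ k m → P (suc k ∷ m) ≗ fold (λ a → -1ℤ * (one a * onePS m + 𝐄 (P m) a)) (−1+ h) k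
P-suc zero    m a = Φ<-𝐄 (degree m) (onePS m) (ℒ m)
  (Φ-zero (degree m) (λ b e → ℒ-support m b (ℕₚ.≤-reflexive (sym e)))) a
P-suc (suc k) m a = trans (Φ<-prefix (suc (k ℕ.+ degree m)) (ℒ (suc k ∷ m)) a)
                          (lin-cong -1ℤ _ (P-suc k m) a)

-- Transposition of ribbons

swap : Letter → Letter
swap h = v
swap v = h

ρ : Word → Word
ρ []      = []
ρ (c ∷ a) = ρ a ∷ʳ swap c

lin-∷ʳ : ∀ x κ F u c d → lin x κ F ((u ∷ʳ c) ∷ʳ d) ≡ lin x κ (F ∘ (_∷ʳ d)) (u ∷ʳ c)
lin-∷ʳ x κ F []      c d = refl
lin-∷ʳ x κ F (_ ∷ _) c d = refl

-- `ρ` reverses words, so a left factor becomes a right factor with h and v exchanged.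
lin-ρ : ∀ x {κ μ} → (∀ c → κ (swap c) ≡ μ c) → ∀ F a → lin x κ F (ρ a) ≡ linʳ x μ (F ∘ ρ) a
lin-ρ x e F []       = refl
lin-ρ x e F (c ∷ []) = cong (λ z → x * F (swap c ∷ []) + z * F []) (e c)
lin-ρ x {κ} {μ} e F (c ∷ d ∷ a) =
  trans (lin-∷ʳ x κ F (ρ a) (swap d) (swap c)) (lin-ρ x e (F ∘ (_∷ʳ swap c)) (d ∷ a))

one-ρ : ∀ a → one (ρ a) ≡ one a
one-ρ []      = refl
one-ρ (c ∷ a) = one-∷ʳ (ρ a) (swap c)
  where
  one-∷ʳ : ∀ u c → one (u ∷ʳ c) ≡ 0ℤ
  one-∷ʳ []      c = refl
  one-∷ʳ (_ ∷ _) c = refl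

Pᵗ : Monomial → Series
Pᵗ m = P m ∘ ρ

Pᵗ-suc : ∀ k m → Pᵗ (suc k ∷ m) ≗ fold (λ a → -1ℤ * (one a * onePS m + 𝐄ʳ (Pᵗ m) a)) (−1+ʳ v) k
Pᵗ-suc k m a = trans (P-suc k m (ρ a)) (row k a)
  where
  δ-swap : ∀ c → - δ h (swap c) ≡ - δ v c
  δ-swap h = refl
  δ-swap v = refl

  row : ∀ k a → fold (λ a → -1ℤ * (one a * onePS m + 𝐄 (P m) a)) (−1+ h) k (ρ a)
              ≡ fold (λ a → -1ℤ * (one a * onePS m + 𝐄ʳ (Pᵗ m) a)) (−1+ʳ v) k a
  row zero    a = cong₂ (λ x y → -1ℤ * (x * onePS m + y)) (one-ρ a) (lin-ρ 1ℤ (λ _ → refl) (P m) a)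
  row (suc k) a = trans (lin-ρ -1ℤ δ-swap _ a) (linʳ-cong -1ℤ _ (row k) a)

−𝐄ʳ-scale : ∀ F a → −𝐄ʳ F a ≡ 𝐄ʳ (λ b → -1ℤ * F b) a
−𝐄ʳ-scale F []       = lemma (F [])
  where
  lemma : ∀ p → -1ℤ * p ≡ 1ℤ * (-1ℤ * p)
  lemma = solve-∀
−𝐄ʳ-scale F (c ∷ []) = lemma (F (c ∷ [])) (F [])
  where
  lemma : ∀ p q → -1ℤ * p + -1ℤ * q ≡ 1ℤ * (-1ℤ * p) + 1ℤ * (-1ℤ * q)
  lemma = solve-∀
−𝐄ʳ-scale F (c ∷ d ∷ a) = −𝐄ʳ-scale (F ∘ (c ∷_)) (d ∷ a)

-- By `𝒯-one` and `Pᵗ-suc` both sides arise by the same right multiplications by -(1 + v), one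
-- variable at a time; only the place of E differs, and `base` settles it.
𝒯-one≗Pᵗ : ∀ m a → 𝒯 m one a ≡ one a * onePS m + 𝐄 (Pᵗ m) a
𝒯-one≗Pᵗ [] a =
  sym (trans (cong₂ _+_ (ℤₚ.*-identityʳ (one a)) (lin-zero 1ℤ (const 1ℤ) (λ _ → refl) a))
             (ℤₚ.+-identityʳ (one a)))
𝒯-one≗Pᵗ (zero ∷ m)  a = 𝒯-one≗Pᵗ m a
𝒯-one≗Pᵗ (suc k ∷ m) a = begin
  𝒯 (suc k ∷ m) one a
    ≡⟨ 𝒯-one (suc k) m a ⟩
  tʳ (suc k) (𝒯 m one) a
    ≡⟨ tʳ-cong (suc k) (𝒯-one≗Pᵗ m) a ⟩
  fold (−𝐄ʳ (λ b → one b * onePS m + 𝐄 (Pᵗ m) b)) (−1+ʳ v) k a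
    ≡⟨ fold-linʳ-cong -1ℤ _ base k a ⟨
  fold (𝐄 (λ b → -1ℤ * (one b * onePS m + 𝐄ʳ (Pᵗ m) b))) (−1+ʳ v) k a
    ≡⟨ lin-fold-linʳ-comm 1ℤ (const 1ℤ) -1ℤ _ _ k a ⟨
  𝐄 (fold (λ b → -1ℤ * (one b * onePS m + 𝐄ʳ (Pᵗ m) b)) (−1+ʳ v) k) a
    ≡⟨ lin-cong 1ℤ (const 1ℤ) (Pᵗ-suc k m) a ⟨
  𝐄 (Pᵗ (suc k ∷ m)) a
    ≡⟨ ℤₚ.+-identityˡ _ ⟨
  0ℤ + 𝐄 (Pᵗ (suc k ∷ m)) a
    ≡⟨ cong (λ z → z + 𝐄 (Pᵗ (suc k ∷ m)) a) (ℤₚ.*-zeroʳ (one a)) ⟨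
  one a * 0ℤ + 𝐄 (Pᵗ (suc k ∷ m)) a ∎
  where
  s = onePS m
  lemma : ∀ p q s → -1ℤ * (p * s + q) ≡ - s * p + -1ℤ * q
  lemma = solve-∀

  -- Up to sign this is E (s + Pᵗ E) = (s + E Pᵗ) E.
  base : 𝐄 (λ b → -1ℤ * (one b * s + 𝐄ʳ (Pᵗ m) b)) ≗ −𝐄ʳ (λ b → one b * s + 𝐄 (Pᵗ m) b)
  base a = begin
    𝐄 (λ b → -1ℤ * (one b * s + 𝐄ʳ (Pᵗ m) b)) a
      ≡⟨ lin-cong 1ℤ (const 1ℤ) (λ b → lemma (one b) (𝐄ʳ (Pᵗ m) b) s) a ⟩
    𝐄 (λ b → - s * one b + -1ℤ * 𝐄ʳ (Pᵗ m) b) a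
      ≡⟨ lin-linear 1ℤ (const 1ℤ) (- s) -1ℤ one (𝐄ʳ (Pᵗ m)) a ⟩
    - s * 𝐄 one a + -1ℤ * 𝐄 (𝐄ʳ (Pᵗ m)) a
      ≡⟨ cong₂ (λ x y → - s * x + -1ℤ * y) (lin-one 1ℤ (const 1ℤ) a)
               (lin-linʳ-comm 1ℤ (const 1ℤ) 1ℤ (const 1ℤ) (Pᵗ m) a) ⟩
    - s * 𝐄ʳ one a + -1ℤ * 𝐄ʳ (𝐄 (Pᵗ m)) a
      ≡⟨ linʳ-linear 1ℤ (const 1ℤ) (- s) -1ℤ one (𝐄 (Pᵗ m)) a ⟨
    𝐄ʳ (λ b → - s * one b + -1ℤ * 𝐄 (Pᵗ m) b) a
      ≡⟨ linʳ-cong 1ℤ (const 1ℤ) (λ b → lemma (one b) (𝐄 (Pᵗ m) b) s) a ⟨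
    𝐄ʳ (λ b → -1ℤ * (one b * s + 𝐄 (Pᵗ m) b)) a
      ≡⟨ −𝐄ʳ-scale (λ b → one b * s + 𝐄 (Pᵗ m) b) a ⟨
    −𝐄ʳ (λ b → one b * s + 𝐄 (Pᵗ m) b) a ∎

-- Set-valued partitions

≡true : ∀ {b} → T b → b ≡ true
≡true {true} _ = refl

≡false : ∀ {b} → ¬ T b → b ≡ false
≡false {true}  n = ⊥-elim (n tt)
≡false {false} n = refl

fromTrue : ∀ {b} → b ≡ true → T b
fromTrue refl = tt

≤ᵇ-true : ∀ {m n} → m ≤ n → (m ≤ᵇ n) ≡ true
≤ᵇ-true p = ≡true (ℕₚ.≤⇒≤ᵇ p)

<ᵇ-true : ∀ {m n} → m < n → (m <ᵇ n) ≡ true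
<ᵇ-true p = ≡true (ℕₚ.<⇒<ᵇ p)

<ᵇ-false : ∀ {m n} → n ≤ m → (m <ᵇ n) ≡ false
<ᵇ-false {m} p = ≡false (λ q → ℕₚ.≤⇒≯ p (ℕₚ.<ᵇ⇒< m _ q))

≤ᵇ-false : ∀ {m n} → n < m → (m ≤ᵇ n) ≡ false
≤ᵇ-false {m} p = ≡false (λ q → ℕₚ.<⇒≱ p (ℕₚ.≤ᵇ⇒≤ m _ q))

≡ᵇ-refl : ∀ n → (n ≡ᵇ n) ≡ true
≡ᵇ-refl zero    = refl
≡ᵇ-refl (suc n) = ≡ᵇ-refl n

≡ᵇ-false : ∀ {m n} → m ≢ n → (m ≡ᵇ n) ≡ false
≡ᵇ-false {m} ne = ≡false (ne ∘ ℕₚ.≡ᵇ⇒≡ m _)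

∑-cong-All : {A : Set} {Q : A → Set} {xs : List A} {f g : A → ℤ} →
  All Q xs → (∀ x → Q x → f x ≡ g x) → ∑ xs f ≡ ∑ xs g
∑-cong-All []             e = refl
∑-cong-All (_∷_ {x} q qs) e = cong₂ _+_ (e x q) (∑-cong-All qs e)

∑-zero : {A : Set} (xs : List A) → ∑ xs (const 0ℤ) ≡ 0ℤ
∑-zero []       = refl
∑-zero (_ ∷ xs) = trans (ℤₚ.+-identityˡ _) (∑-zero xs)

𝟙 : Bool → ℤ
𝟙 b = if b then 1ℤ else 0ℤ

length-filter : {A : Set} (p : A → Bool) (xs : List A) → + length (filter p xs) ≡ ∑ xs (𝟙 ∘ p)
length-filter p []       = refl
length-filter p (x ∷ xs) with p x
... | true  = cong (λ z → 1ℤ + z) (length-filter p xs)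
... | false = trans (length-filter p xs) (sym (ℤₚ.+-identityˡ _))

filter-++ : {A : Set} (p : A → Bool) (xs ys : List A) → filter p (xs ++ ys) ≡ filter p xs ++ filter p ys
filter-++ p []       ys = refl
filter-++ p (x ∷ xs) ys with p x
... | true  = cong (x ∷_) (filter-++ p xs ys)
... | false = filter-++ p xs ys

filter-nonempty-map : ∀ x xss → filter nonemptyᵇ (map (x ∷_) xss) ≡ map (x ∷_) xss
filter-nonempty-map x []         = refl
filter-nonempty-map x (xs ∷ xss) = cong ((x ∷ xs) ∷_) (filter-nonempty-map x xss)

∑-tuples : {A : Set} (n : ℕ) (xs : List A) (f : List A → ℤ) →
  ∑ (tuples (suc n) xs) f ≡ ∑ xs (λ x → ∑ (tuples n xs) (f ∘ (x ∷_)))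
∑-tuples n xs f =
  trans (∑-concatMap (λ x → map (x ∷_) (tuples n xs)) f xs)
        (∑-cong xs (λ x → ∑-map (x ∷_) f (tuples n xs)))

-- Nonempty subsets of an interval and tuples of them

interval : ℕ → ℕ → List ℕ
interval p zero    = []
interval p (suc n) = suc p ∷ interval (suc p) n

interval-above : ∀ p n → All (p <_) (interval p n)
interval-above p zero    = []
interval-above p (suc n) = ℕₚ.≤-refl ∷ All.map ℕₚ.<⇒≤ (interval-above (suc p) n)

length-interval : ∀ p n → length (interval p n) ≡ n
length-interval p zero    = refl
length-interval p (suc n) = cong suc (length-interval (suc p) n)

range≡interval : ∀ n → range n ≡ interval 0 n
range≡interval n = trans (map-applyUpTo (λ i → i) suc n) (shift 0 n suc (λ _ → refl))
  where
  shift : ∀ p n f → (∀ i → f i ≡ suc p ℕ.+ i) → applyUpTo f n ≡ interval p n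
  shift p zero    f e = refl
  shift p (suc n) f e = cong₂ _∷_ (trans (e 0) (cong suc (ℕₚ.+-identityʳ p)))
    (shift (suc p) n (f ∘ suc) (λ i → trans (e (suc i)) (cong suc (ℕₚ.+-suc p i))))

subsetsOf-nonempty : ∀ xs → subsetsOf xs ≡ [] ∷ filter nonemptyᵇ (subsetsOf xs)
subsetsOf-nonempty []       = refl
subsetsOf-nonempty (x ∷ xs) = begin
  subsetsOf xs ++ map (x ∷_) (subsetsOf xs)
    ≡⟨ cong₂ _++_ (subsetsOf-nonempty xs) (sym (filter-nonempty-map x (subsetsOf xs))) ⟩
  [] ∷ (filter nonemptyᵇ (subsetsOf xs) ++ filter nonemptyᵇ (map (x ∷_) (subsetsOf xs)))
    ≡⟨ cong ([] ∷_) (filter-++ nonemptyᵇ (subsetsOf xs) _) ⟨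
  [] ∷ filter nonemptyᵇ (subsetsOf (x ∷ xs)) ∎

-- The values run from p + 1 to p + k. The lower end is a parameter because discarding the first
-- variable raises it instead of renumbering the values.
U : ℕ → ℕ → List (List ℕ)
U p k = filter nonemptyᵇ (subsetsOf (interval p k))

U-suc : ∀ p k → U p (suc k) ≡ U (suc p) k ++ (suc p ∷ []) ∷ map (suc p ∷_) (U (suc p) k)
U-suc p k = begin
  filter nonemptyᵇ (subsetsOf I ++ map (suc p ∷_) (subsetsOf I))
    ≡⟨ filter-++ nonemptyᵇ (subsetsOf I) _ ⟩
  U (suc p) k ++ filter nonemptyᵇ (map (suc p ∷_) (subsetsOf I))
    ≡⟨ cong (U (suc p) k ++_) (filter-nonempty-map (suc p) (subsetsOf I)) ⟩
  U (suc p) k ++ map (suc p ∷_) (subsetsOf I)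
    ≡⟨ cong (λ z → U (suc p) k ++ map (suc p ∷_) z) (subsetsOf-nonempty I) ⟩
  U (suc p) k ++ (suc p ∷ []) ∷ map (suc p ∷_) (U (suc p) k) ∎
  where
  I = interval (suc p) k

∑-U : ∀ p k f →
  ∑ (U p (suc k)) f ≡ ∑ (U (suc p) k) f + (f (suc p ∷ []) + ∑ (U (suc p) k) (f ∘ (suc p ∷_)))
∑-U p k f = begin
  ∑ (U p (suc k)) f
    ≡⟨ cong (λ z → ∑ z f) (U-suc p k) ⟩
  ∑ (U (suc p) k ++ (suc p ∷ []) ∷ map (suc p ∷_) (U (suc p) k)) f
    ≡⟨ ∑-++ f (U (suc p) k) _ ⟩
  ∑ (U (suc p) k) f + (f (suc p ∷ []) + ∑ (map (suc p ∷_) (U (suc p) k)) f)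
    ≡⟨ cong (λ z → ∑ (U (suc p) k) f + (f (suc p ∷ []) + z)) (∑-map (suc p ∷_) f (U (suc p) k)) ⟩
  ∑ (U (suc p) k) f + (f (suc p ∷ []) + ∑ (U (suc p) k) (f ∘ (suc p ∷_))) ∎

foldr-⊓-≤ : ∀ x s → foldr _⊓_ x s ≤ x
foldr-⊓-≤ x []      = ℕₚ.≤-refl
foldr-⊓-≤ x (y ∷ s) = ℕₚ.≤-trans (ℕₚ.m⊓n≤n y _) (foldr-⊓-≤ x s)

<foldr-⊓ : ∀ {p x s} → p < x → All (p <_) s → p < foldr _⊓_ x s
<foldr-⊓ px []       = px
<foldr-⊓ px (q ∷ qs) = ℕₚ.⊓-glb q (<foldr-⊓ px qs)

<foldr-⊓⁻ : ∀ {p x} s → p < foldr _⊓_ x s → All (p <_) s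
<foldr-⊓⁻ []      q = []
<foldr-⊓⁻ (y ∷ s) q =
  ℕₚ.<-≤-trans q (ℕₚ.m⊓n≤m y _) ∷ <foldr-⊓⁻ s (ℕₚ.<-≤-trans q (ℕₚ.m⊓n≤n y _))

<minL⁻ : ∀ {p} s → p < minL s → All (p <_) s
<minL⁻ (x ∷ s) q = ℕₚ.<-≤-trans q (foldr-⊓-≤ x s) ∷ <foldr-⊓⁻ s q

minL≤maxL : ∀ s → minL s ≤ maxL s
minL≤maxL []      = z≤n
minL≤maxL (x ∷ s) = ℕₚ.≤-trans (foldr-⊓-≤ x s) (ℕₚ.m≤m⊔n x (maxL s))

<minL-∷ : ∀ {p s} → suc p < minL s → p < minL (suc p ∷ s)
<minL-∷ {p} {s} q = <foldr-⊓ ℕₚ.≤-refl (All.map ℕₚ.<⇒≤ (<minL⁻ s q))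

U-above : ∀ p k → All (λ s → p < minL s) (U p k)
U-above p zero    = []
U-above p (suc k) rewrite U-suc p k =
  All-++⁺ (All.map ℕₚ.<⇒≤ (U-above (suc p) k))
          (ℕₚ.≤-refl ∷ All-map⁺ (All.map (λ {s} → <minL-∷ {p} {s}) (U-above (suc p) k)))

-- The strict bound also excludes empty sets, whose `minL` is 0.
data Above (p : ℕ) : ℕ → List (List ℕ) → Set where
  []  : Above p 0 []
  _∷_ : ∀ {n s σ} → p < minL s → Above p n σ → Above p (suc n) (s ∷ σ)

-- Here p + 1 is the smallest value available, so a set containing it lists it first.

data Hits (p : ℕ) : List (List ℕ) → Set where
  here  : ∀ {s σ} → Hits p ((suc p ∷ s) ∷ σ)
  there : ∀ {s σ} → Hits p σ → Hits p (s ∷ σ)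

∑-tuples-cong : ∀ n p k {f g} → (∀ σ → Above p n σ → f σ ≡ g σ) →
  ∑ (tuples n (U p k)) f ≡ ∑ (tuples n (U p k)) g
∑-tuples-cong zero    p k e = cong (λ z → z + 0ℤ) (e [] [])
∑-tuples-cong (suc n) p k {f} {g} e =
  trans (∑-tuples n (U p k) f)
  (trans (∑-cong-All (U-above p k) (λ s q → ∑-tuples-cong n p k (λ σ r → e (s ∷ σ) (q ∷ r))))
         (sym (∑-tuples n (U p k) g)))

∑-tuples-zero : ∀ n p k {f} → (∀ σ → Above p n σ → f σ ≡ 0ℤ) → ∑ (tuples n (U p k)) f ≡ 0ℤ
∑-tuples-zero n p k e = trans (∑-tuples-cong n p k e) (∑-zero (tuples n (U p k)))

-- A tuple in which p + 1 never occurs is already a tuple over the shorter interval, and the others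
-- contribute zero.
∑-tuples-raise : ∀ n p k f → (∀ σ → Above p n σ → Hits p σ → f σ ≡ 0ℤ) →
  ∑ (tuples n (U p (suc k))) f ≡ ∑ (tuples n (U (suc p) k)) f
∑-tuples-raise zero    p k f e = refl
∑-tuples-raise (suc n) p k f e = begin
  ∑ (tuples (suc n) (U p (suc k))) f
    ≡⟨ ∑-tuples n (U p (suc k)) f ⟩
  ∑ (U p (suc k)) F
    ≡⟨ ∑-U p k F ⟩
  ∑ (U (suc p) k) F + (F (suc p ∷ []) + ∑ (U (suc p) k) (F ∘ (suc p ∷_)))
    ≡⟨ cong₂ _+_
         (∑-cong-All (U-above (suc p) k) (λ s q →
           ∑-tuples-raise n p k (f ∘ (s ∷_)) (λ σ r hit → e (s ∷ σ) (ℕₚ.<⇒≤ q ∷ r) (there hit))))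
         (cong₂ _+_ (hit [] ℕₚ.≤-refl)
           (trans (∑-cong-All (U-above (suc p) k) (λ s q → hit s (<minL-∷ {p} {s} q)))
                  (∑-zero (U (suc p) k)))) ⟩
  ∑ (U (suc p) k) (λ s → ∑ (tuples n (U (suc p) k)) (f ∘ (s ∷_))) + 0ℤ
    ≡⟨ ℤₚ.+-identityʳ _ ⟩
  ∑ (U (suc p) k) (λ s → ∑ (tuples n (U (suc p) k)) (f ∘ (s ∷_)))
    ≡⟨ ∑-tuples n (U (suc p) k) f ⟨
  ∑ (tuples (suc n) (U (suc p) k)) f ∎
  where
  F : List ℕ → ℤ
  F s = ∑ (tuples n (U p (suc k))) (f ∘ (s ∷_))

  hit : ∀ s → p < minL (suc p ∷ s) → F (suc p ∷ s) ≡ 0ℤ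
  hit s q = ∑-tuples-zero n p (suc k) (λ σ r → e ((suc p ∷ s) ∷ σ) (q ∷ r) here)

-- Validity and weight of a tuple

ok : Letter → List ℕ → List ℕ → Bool
ok h s t = maxL s ≤ᵇ minL t
ok v s t = maxL s <ᵇ minL t

valid : Word → List (List ℕ) → Bool
valid (c ∷ a) (s ∷ t ∷ σ) = ok c s t ∧ valid a (t ∷ σ)
valid _       _           = true

ok⇒≤ : ∀ c s t → ok c s t ≡ true → maxL s ≤ minL t
ok⇒≤ h s t e = ℕₚ.≤ᵇ⇒≤ (maxL s) (minL t) (fromTrue e)
ok⇒≤ v s t e = ℕₚ.<⇒≤ (ℕₚ.<ᵇ⇒< (maxL s) (minL t) (fromTrue e))

ok-false : ∀ c s t → minL t < maxL s → ok c s t ≡ false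
ok-false h s t q = ≤ᵇ-false q
ok-false v s t q = <ᵇ-false (ℕₚ.<⇒≤ q)

-- In a valid tuple the maxima increase weakly and each minimum is at least the preceding maximum.
-- Once a maximum exceeds p + 1, no later set can contain p + 1.
valid-hits : ∀ {p} a s σ → suc p < maxL s → Above p (length a) σ → Hits p σ → valid a (s ∷ σ) ≡ false
valid-hits {p} (c ∷ a) s ((_ ∷ t) ∷ σ) q (_ ∷ r) here
  rewrite ok-false c s (suc p ∷ t) (ℕₚ.≤-<-trans (foldr-⊓-≤ (suc p) t) q) = refl
valid-hits (c ∷ a) s (t ∷ σ) q (_ ∷ r) (there hit) with ok c s t in e
... | false = refl
... | true  = valid-hits a t σ (ℕₚ.<-≤-trans q (ℕₚ.≤-trans (ok⇒≤ c s t e) (minL≤maxL t))) r hit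

-- The strict inequality at v already puts the second set above p + 1, and `valid-hits` covers the
-- rest.
valid-hits-v : ∀ {p} a σ → Above p (suc (length a)) σ → Hits p σ →
  valid (v ∷ a) ((suc p ∷ []) ∷ σ) ≡ false
valid-hits-v {p} a ((_ ∷ t) ∷ σ) (_ ∷ r) here
  rewrite <ᵇ-false {suc p ⊔ 0} (ℕₚ.≤-trans (foldr-⊓-≤ (suc p) t) (ℕₚ.m≤m⊔n (suc p) 0)) = refl
valid-hits-v {p} a (t ∷ σ) (_ ∷ r) (there hit) with (suc p ⊔ 0) <ᵇ minL t in e
... | false = refl
... | true  = valid-hits a t σ (ℕₚ.<-≤-trans (ℕₚ.≤-<-trans (ℕₚ.m≤m⊔n (suc p) 0)
                (ℕₚ.<ᵇ⇒< (suc p ⊔ 0) (minL t) (fromTrue e))) (minL≤maxL t)) r hit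

-- The first set enters the conditions only through its maximum, so p + 1 can be removed from a
-- larger first set without affecting validity.
valid-maxL : ∀ a s s′ σ → maxL s ≡ maxL s′ → valid a (s ∷ σ) ≡ valid a (s′ ∷ σ)
valid-maxL []      s s′ σ       e = refl
valid-maxL (c ∷ a) s s′ []      e = refl
valid-maxL (h ∷ a) s s′ (t ∷ σ) e = cong (λ z → (z ≤ᵇ minL t) ∧ valid a (t ∷ σ)) e
valid-maxL (v ∷ a) s s′ (t ∷ σ) e = cong (λ z → (z <ᵇ minL t) ∧ valid a (t ∷ σ)) e

has : ℕ → List ℕ → Bool
has j = any (j ≡ᵇ_)

mult : ℕ → List (List ℕ) → ℕ
mult j σ = length (filter (has j) σ)

weight : List ℕ → List (List ℕ) → Monomial
weight I σ = map (λ j → mult j σ) I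

has-∉ : ∀ {j s} → All (j <_) s → has j s ≡ false
has-∉ []       = refl
has-∉ (q ∷ qs) rewrite ≡ᵇ-false (ℕₚ.<⇒≢ q) = has-∉ qs

has-∷ : ∀ {p j} s → suc p < j → has j (suc p ∷ s) ≡ has j s
has-∷ s q rewrite ≡ᵇ-false (ℕₚ.>⇒≢ q) = refl

mult-above : ∀ {p n σ} → Above (suc p) n σ → mult (suc p) σ ≡ 0
mult-above []                  = refl
mult-above (_∷_ {s = s} q qs) rewrite has-∉ (<minL⁻ s q) = mult-above qs

mult-∷ : ∀ p s σ → mult (suc p) ((suc p ∷ s) ∷ σ) ≡ suc (mult (suc p) σ)
mult-∷ p s σ rewrite ≡ᵇ-refl p = refl

mult-∷-above : ∀ {p n σ} s → Above (suc p) n σ → mult (suc p) ((suc p ∷ s) ∷ σ) ≡ 1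
mult-∷-above {p} {σ = σ} s r = trans (mult-∷ p s σ) (cong suc (mult-above r))

mult-hits : ∀ {p σ} → Hits p σ → mult (suc p) σ ≢ 0
mult-hits {p} (here {s} {σ}) e with () ← trans (sym (mult-∷ p s σ)) e
mult-hits {p} (there {s} {σ} hit) e with has (suc p) s
... | true  with () ← e
... | false = mult-hits hit e

weight-∷ : ∀ p k s σ →
  weight (interval (suc p) k) ((suc p ∷ s) ∷ σ) ≡ weight (interval (suc p) k) (s ∷ σ)
weight-∷ p k s σ = map-cong-local (All.map step (interval-above (suc p) k))
  where
  step : ∀ {j} → suc p < j → mult j ((suc p ∷ s) ∷ σ) ≡ mult j (s ∷ σ)
  step {j} q rewrite has-∷ {p} {j} s q with has j s
  ... | true  = refl
  ... | false = refl

weight-singleton : ∀ p k σ →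
  weight (interval (suc p) k) ((suc p ∷ []) ∷ σ) ≡ weight (interval (suc p) k) σ
weight-singleton p k σ = weight-∷ p k [] σ

-- Recursion of the count in the first variable

term : ℕ → Word → Monomial → List (List ℕ) → ℤ
term p a m σ = 𝟙 (valid a σ ∧ eqL (weight (interval p (length m)) σ) m)

count : ℕ → Word → Monomial → ℤ
count p a m = ∑ (tuples (suc (length a)) (U p (length m))) (term p a m)

𝟙-∧-false : ∀ {b c} → b ≡ false → 𝟙 (b ∧ c) ≡ 0ℤ
𝟙-∧-false refl = refl

𝟙-∧∧-false : ∀ b {c d} → c ≡ false → 𝟙 (b ∧ (c ∧ d)) ≡ 0ℤ
𝟙-∧∧-false true  refl = refl
𝟙-∧∧-false false refl = refl

count-zero : ∀ p a m → count p a (0 ∷ m) ≡ count (suc p) a m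
count-zero p a m =
  trans (∑-tuples-raise (suc (length a)) p (length m) (term p a (0 ∷ m))
          (λ σ _ hit → 𝟙-∧∧-false (valid a σ) (≡ᵇ-false (mult-hits hit))))
        (∑-tuples-cong (suc (length a)) (suc p) (length m) step)
  where
  step : ∀ σ → Above (suc p) (suc (length a)) σ → term p a (0 ∷ m) σ ≡ term (suc p) a m σ
  step σ q rewrite mult-above q = refl

-- The factor [k = 0]: when the value p + 1 is used exactly once, the exponent `suc k` must be 1.
gate : ℕ → ℤ → ℤ
gate zero    x = x
gate (suc _) x = 0ℤ

gate-𝟙 : ∀ b c k → 𝟙 (b ∧ ((1 ≡ᵇ suc k) ∧ c)) ≡ gate k (𝟙 (b ∧ c))
gate-𝟙 b c zero    = refl
gate-𝟙 b c (suc k) = 𝟙-∧∧-false b {d = c} refl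

∑-gate : {A : Set} (xs : List A) (k : ℕ) (f : A → ℤ) → ∑ xs (gate k ∘ f) ≡ gate k (∑ xs f)
∑-gate xs zero    f = refl
∑-gate xs (suc k) f = ∑-zero xs

-- The contribution of the first set {p + 1}. After h, the value p + 1 may occur k more times; after
-- v, or if no box follows, it cannot occur again.
first : ℕ → Word → ℕ → Monomial → ℤ
first p []      k m = gate k (onePS m)
first p (h ∷ a) k m = count p a (k ∷ m)
first p (v ∷ a) k m = gate k (count (suc p) a m)

weight-[] : ∀ I m → length I ≡ length m → 𝟙 (eqL (weight I []) m) ≡ onePS m
weight-[] []      []            e = refl
weight-[] (j ∷ I) (zero ∷ m)    e = weight-[] I m (ℕₚ.suc-injective e)
weight-[] (j ∷ I) (suc k ∷ m)   e = refl

module FirstVariable (p : ℕ) (a : Word) (k : ℕ) (m : Monomial) where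

  n N : ℕ
  n = length a
  N = length m

  I : List ℕ
  I = interval (suc p) N

  from : List ℕ → ℤ
  from s = ∑ (tuples n (U p (suc N))) (λ σ → term p a (suc k ∷ m) (s ∷ σ))

  from-above : ∀ s → suc p < minL s → from s ≡ 0ℤ
  from-above s q =
    trans (∑-tuples-raise n p N _ (λ σ r hit →
            𝟙-∧-false (valid-hits a s σ (ℕₚ.<-≤-trans q (minL≤maxL s)) r hit)))
          (∑-tuples-zero n (suc p) N (λ σ r →
            𝟙-∧∧-false (valid a (s ∷ σ)) (cong (_≡ᵇ suc k) (mult-above {σ = s ∷ σ} (q ∷ r)))))

  -- The maximum of the first set exceeds p + 1, so p + 1 occurs in this set alone; removing it
  -- there leaves a valid tuple over the higher values.
  from-∷ : ∀ s → suc p < minL s →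
    from (suc p ∷ s) ≡ ∑ (tuples n (U (suc p) N)) (λ σ → gate k (term (suc p) a m (s ∷ σ)))
  from-∷ s q =
    trans (∑-tuples-raise n p N _ (λ σ r hit →
            𝟙-∧-false (valid-hits a (suc p ∷ s) σ
              (ℕₚ.<-≤-trans (ℕₚ.<-≤-trans q (minL≤maxL s)) (ℕₚ.m≤n⊔m (suc p) (maxL s))) r hit)))
          (∑-tuples-cong n (suc p) N step)
    where
    step : ∀ σ → Above (suc p) n σ →
      term p a (suc k ∷ m) ((suc p ∷ s) ∷ σ) ≡ gate k (term (suc p) a m (s ∷ σ))
    step σ r
      rewrite valid-maxL a (suc p ∷ s) s σ (ℕₚ.m≤n⇒m⊔n≡n (ℕₚ.<⇒≤ (ℕₚ.<-≤-trans q (minL≤maxL s))))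
            | mult-∷-above s r | weight-∷ p N s σ
      = gate-𝟙 (valid a (s ∷ σ)) _ k

from-singleton : ∀ p a k m → FirstVariable.from p a k m (suc p ∷ []) ≡ first p a k m
from-singleton p [] k m = trans (ℤₚ.+-identityʳ _) step
  where
  step : term p [] (suc k ∷ m) ((suc p ∷ []) ∷ []) ≡ gate k (onePS m)
  step rewrite mult-∷ p [] [] | weight-singleton p (length m) [] =
    trans (gate-𝟙 true _ k) (cong (gate k)
      (weight-[] (interval (suc p) (length m)) m (length-interval (suc p) (length m))))
from-singleton p (h ∷ a) k m = ∑-tuples-cong (suc (length a)) p (suc (length m)) step
  where
  step : ∀ σ → Above p (suc (length a)) σ →
    term p (h ∷ a) (suc k ∷ m) ((suc p ∷ []) ∷ σ) ≡ term p a (k ∷ m) σ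
  step (t ∷ σ) (q ∷ r)
    rewrite ≤ᵇ-true {suc p ⊔ 0} (ℕₚ.⊔-lub q z≤n) | mult-∷ p [] (t ∷ σ)
          | weight-singleton p (length m) (t ∷ σ) = refl
from-singleton p (v ∷ a) k m =
  trans (∑-tuples-raise (suc (length a)) p (length m) _
          (λ σ r hit → 𝟙-∧-false (valid-hits-v a σ r hit)))
  (trans (∑-tuples-cong (suc (length a)) (suc p) (length m) step)
         (∑-gate (tuples (suc (length a)) (U (suc p) (length m))) k _))
  where
  step : ∀ σ → Above (suc p) (suc (length a)) σ →
    term p (v ∷ a) (suc k ∷ m) ((suc p ∷ []) ∷ σ) ≡ gate k (term (suc p) a m σ)
  step (t ∷ σ) (q ∷ r)
    rewrite <ᵇ-true {suc p ⊔ 0} (ℕₚ.⊔-lub q (ℕₚ.≤-trans (s≤s z≤n) q))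
          | mult-∷-above {σ = t ∷ σ} [] (q ∷ r)
          | weight-singleton p (length m) (t ∷ σ)
    = gate-𝟙 (valid a (t ∷ σ)) _ k

-- The first set either avoids p + 1, and then p + 1 occurs nowhere; or is {p + 1}; or contains p +
-- 1 together with larger values.
count-suc : ∀ p a k m → count p a (suc k ∷ m) ≡ first p a k m + gate k (count (suc p) a m)
count-suc p a k m = begin
  count p a (suc k ∷ m)
    ≡⟨ ∑-tuples n (U p (suc N)) (term p a (suc k ∷ m)) ⟩
  ∑ (U p (suc N)) from
    ≡⟨ ∑-U p N from ⟩
  ∑ (U (suc p) N) from + (from (suc p ∷ []) + ∑ (U (suc p) N) (from ∘ (suc p ∷_)))
    ≡⟨ cong₂ _+_ (trans (∑-cong-All (U-above (suc p) N) from-above) (∑-zero (U (suc p) N)))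
         (cong₂ _+_ (from-singleton p a k m) rest) ⟩
  0ℤ + (first p a k m + gate k (count (suc p) a m))
    ≡⟨ ℤₚ.+-identityˡ _ ⟩
  first p a k m + gate k (count (suc p) a m) ∎
  where
  open FirstVariable p a k m

  rest : ∑ (U (suc p) N) (from ∘ (suc p ∷_)) ≡ gate k (count (suc p) a m)
  rest = begin
    ∑ (U (suc p) N) (from ∘ (suc p ∷_))
      ≡⟨ ∑-cong-All (U-above (suc p) N) from-∷ ⟩
    ∑ (U (suc p) N) (λ s → ∑ (tuples n (U (suc p) N)) (λ σ → gate k (term (suc p) a m (s ∷ σ))))
      ≡⟨ ∑-tuples n (U (suc p) N) (gate k ∘ term (suc p) a m) ⟨
    ∑ (tuples (suc n) (U (suc p) N)) (gate k ∘ term (suc p) a m)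
      ≡⟨ ∑-gate (tuples (suc n) (U (suc p) N)) k _ ⟩
    gate k (count (suc p) a m) ∎

count≡ℒ : ∀ m p a → count p a m ≡ ℒ m a
count≡ℒ []         p a = refl
count≡ℒ (zero ∷ m) p a = trans (count-zero p a m) (count≡ℒ m (suc p) a)
count≡ℒ (suc zero ∷ m) p a = trans (count-suc p a 0 m) (box a)
  where
  lemma₁ : ∀ s x → s + x ≡ 1ℤ * s + 1ℤ * x
  lemma₁ = solve-∀
  lemma₂ : ∀ s x y → x + y ≡ 0ℤ * s + (1ℤ * y + 1ℤ * x)
  lemma₂ = solve-∀

  box : ∀ a → first p a 0 m + count (suc p) a m ≡ one a * onePS m + 𝐄 (ℒ m) a
  box []      = trans (cong (λ z → onePS m + z) (count≡ℒ m (suc p) [])) (lemma₁ (onePS m) (ℒ m []))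
  box (h ∷ a) = trans (cong₂ _+_ (trans (count-zero p a m) (count≡ℒ m (suc p) a))
                                 (count≡ℒ m (suc p) (h ∷ a)))
                      (lemma₂ (onePS m) (ℒ m a) (ℒ m (h ∷ a)))
  box (v ∷ a) = trans (cong₂ _+_ (count≡ℒ m (suc p) a) (count≡ℒ m (suc p) (v ∷ a)))
                      (lemma₂ (onePS m) (ℒ m a) (ℒ m (v ∷ a)))
count≡ℒ (suc (suc k) ∷ m) p a = trans (count-suc p a (suc k) m) (row a)
  where
  lemma₁ : ∀ y → 0ℤ + 0ℤ ≡ 0ℤ * y
  lemma₁ = solve-∀
  lemma₂ : ∀ x y → x + 0ℤ ≡ 0ℤ * y + 1ℤ * x
  lemma₂ = solve-∀
  lemma₃ : ∀ x y → 0ℤ + 0ℤ ≡ 0ℤ * y + 0ℤ * x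
  lemma₃ = solve-∀

  row : ∀ a → first p a (suc k) m + 0ℤ ≡ prefix h (ℒ (suc k ∷ m)) a
  row []      = lemma₁ (ℒ (suc k ∷ m) [])
  row (h ∷ a) = trans (cong (λ z → z + 0ℤ) (count≡ℒ (suc k ∷ m) p a))
                      (lemma₂ (ℒ (suc k ∷ m) a) (ℒ (suc k ∷ m) (h ∷ a)))
  row (v ∷ a) = lemma₃ (ℒ (suc k ∷ m) a) (ℒ (suc k ∷ m) (v ∷ a))

-- Compositions and words

-- The accumulating where-functions of setS, compD and descents have no names in scope; the
-- metavariables below are solved with them once the initial accumulator is abstracted.

mutual
  setSFrom : ℕ → Composition → List ℕ
  setSFrom = _

  setSFrom-0 : ∀ α → setS α ≡ setSFrom 0 α
  setSFrom-0 α with 0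
  ... | p = same p α
    where
    same : ∀ p α → setSFrom p α ≡ setSFrom p α
    same p α = refl

mutual
  compDFrom : ℕ → ℕ → List ℕ → Composition
  compDFrom = _

  compDFrom-0 : ∀ n D → compD (suc n) D ≡ compDFrom n 0 D
  compDFrom-0 n D with 0
  ... | p = same n p D
    where
    same : ∀ n p D → compDFrom n p D ≡ compDFrom n p D
    same n p D = refl

mutual
  descentsFrom : ℕ → List ℕ → List ℕ
  descentsFrom = _

  descentsFrom-1 : ∀ u → descents u ≡ descentsFrom 1 u
  descentsFrom-1 u with 1
  ... | i = same i u
    where
    same : ∀ i u → descentsFrom i u ≡ descentsFrom i u
    same i u = refl

bump : Composition → Composition
bump []      = []
bump (a ∷ r) = suc a ∷ r

fromWord : Word → Composition
fromWord []      = 0 ∷ []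
fromWord (h ∷ b) = bump (fromWord b)
fromWord (v ∷ b) = 0 ∷ fromWord b

bump-≢[] : ∀ {α} → α ≢ [] → bump α ≢ []
bump-≢[] {[]}    ne e = ne refl
bump-≢[] {_ ∷ _} ne ()

fromWord-≢[] : ∀ b → fromWord b ≢ []
fromWord-≢[] []      ()
fromWord-≢[] (h ∷ b) e = bump-≢[] (fromWord-≢[] b) e
fromWord-≢[] (v ∷ b) ()

aWord-bump : ∀ {α} → α ≢ [] → aWord (bump α) ≡ h ∷ aWord α
aWord-bump {[]}        ne = ⊥-elim (ne refl)
aWord-bump {_ ∷ []}    ne = refl
aWord-bump {_ ∷ _ ∷ _} ne = refl

aWord-0∷ : ∀ {α} → α ≢ [] → aWord (0 ∷ α) ≡ v ∷ aWord α
aWord-0∷ {[]}    ne = ⊥-elim (ne refl)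
aWord-0∷ {_ ∷ _} ne = refl

aWord-fromWord : ∀ b → aWord (fromWord b) ≡ b
aWord-fromWord []      = refl
aWord-fromWord (h ∷ b) = trans (aWord-bump (fromWord-≢[] b)) (cong (h ∷_) (aWord-fromWord b))
aWord-fromWord (v ∷ b) = trans (aWord-0∷ (fromWord-≢[] b)) (cong (v ∷_) (aWord-fromWord b))

fromWord-row : ∀ a → fromWord (replicate a h) ≡ a ∷ []
fromWord-row zero    = refl
fromWord-row (suc a) = cong bump (fromWord-row a)

fromWord-row-v : ∀ a b → fromWord (replicate a h ++ v ∷ b) ≡ a ∷ fromWord b
fromWord-row-v zero    b = refl
fromWord-row-v (suc a) b = cong bump (fromWord-row-v a b)

fromWord-aWord : ∀ α → α ≢ [] → fromWord (aWord α) ≡ α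
fromWord-aWord []          ne = ⊥-elim (ne refl)
fromWord-aWord (a ∷ [])    ne = fromWord-row a
fromWord-aWord (a ∷ b ∷ r) ne =
  trans (fromWord-row-v a (aWord (b ∷ r))) (cong (a ∷_) (fromWord-aWord (b ∷ r) (λ ())))

size-bump : ∀ {α} → α ≢ [] → size (bump α) ≡ suc (size α)
size-bump {[]}    ne = ⊥-elim (ne refl)
size-bump {_ ∷ _} ne = refl

size-fromWord : ∀ b → size (fromWord b) ≡ suc (length b)
size-fromWord []      = refl
size-fromWord (h ∷ b) = trans (size-bump (fromWord-≢[] b)) (cong suc (size-fromWord b))
size-fromWord (v ∷ b) = cong suc (size-fromWord b)

-- The positions of v, counted from p + 1.

vpos : ℕ → Word → List ℕ
vpos p []      = []
vpos p (h ∷ b) = vpos (suc p) b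
vpos p (v ∷ b) = suc p ∷ vpos (suc p) b

vpos-above : ∀ p b → All (p <_) (vpos p b)
vpos-above p []      = []
vpos-above p (h ∷ b) = All.map ℕₚ.<⇒≤ (vpos-above (suc p) b)
vpos-above p (v ∷ b) = ℕₚ.≤-refl ∷ All.map ℕₚ.<⇒≤ (vpos-above (suc p) b)

∸-step : ∀ {p s} → suc p < s → (s ∸ p) ∸ 1 ≡ suc ((s ∸ suc p) ∸ 1)
∸-step {p} {s} q = begin
  s ∸ p ∸ 1                ≡⟨ ℕₚ.∸-+-assoc s p 1 ⟩
  s ∸ (p ℕ.+ 1)            ≡⟨ cong (s ∸_) (ℕₚ.+-comm p 1) ⟩
  s ∸ suc p                ≡⟨ ℕₚ.+-∸-assoc 1 q ⟩
  suc (s ∸ suc (suc p))    ≡⟨ cong (λ z → suc (s ∸ z)) (ℕₚ.+-comm 1 (suc p)) ⟩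
  suc (s ∸ (suc p ℕ.+ 1))  ≡⟨ cong suc (ℕₚ.∸-+-assoc s (suc p) 1) ⟨
  suc (s ∸ suc p ∸ 1)      ∎

suc∸∸1 : ∀ p → (suc p ∸ p) ∸ 1 ≡ 0
suc∸∸1 zero    = refl
suc∸∸1 (suc p) = suc∸∸1 p

-- Starting one position earlier lengthens the first part by one. The bounds keep the truncated
-- subtractions from stopping at zero.
compDFrom-bump : ∀ n p D → p < n → All (suc p <_) D → compDFrom n p D ≡ bump (compDFrom n (suc p) D)
compDFrom-bump n p []      q _       = cong (_∷ []) (∸-step (s≤s q))
compDFrom-bump n p (s ∷ D) q (r ∷ _) = cong (_∷ compDFrom n s D) (∸-step r)

compDFrom-vpos : ∀ b p → compDFrom (p ℕ.+ length b) p (vpos p b) ≡ fromWord b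
compDFrom-vpos [] p rewrite ℕₚ.+-identityʳ p = cong (_∷ []) (suc∸∸1 p)
compDFrom-vpos (h ∷ b) p = trans
  (compDFrom-bump _ p (vpos (suc p) b) (ℕₚ.m<m+n p (s≤s z≤n)) (vpos-above (suc p) b))
  (cong bump (trans (cong (λ n → compDFrom n (suc p) (vpos (suc p) b)) (ℕₚ.+-suc p (length b)))
                    (compDFrom-vpos b (suc p))))
compDFrom-vpos (v ∷ b) p = cong₂ _∷_ (suc∸∸1 p)
  (trans (cong (λ n → compDFrom n (suc p) (vpos (suc p) b)) (ℕₚ.+-suc p (length b)))
         (compDFrom-vpos b (suc p)))

compD-vpos : ∀ b → compD (suc (length b)) (vpos 0 b) ≡ fromWord b
compD-vpos b = trans (compDFrom-0 (length b) (vpos 0 b)) (compDFrom-vpos b 0)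

vpos-row : ∀ a p b → vpos p (replicate a h ++ v ∷ b) ≡ p ℕ.+ suc a ∷ vpos (p ℕ.+ suc a) b
vpos-row zero    p b rewrite ℕₚ.+-comm p 1 = refl
vpos-row (suc a) p b rewrite ℕₚ.+-suc p (suc a) = vpos-row a (suc p) b

vpos-last-row : ∀ a p → vpos p (replicate a h) ≡ []
vpos-last-row zero    p = refl
vpos-last-row (suc a) p = vpos-last-row a (suc p)

setSFrom-vpos : ∀ α p → setSFrom p α ≡ vpos p (aWord α)
setSFrom-vpos []          p = refl
setSFrom-vpos (a ∷ [])    p = sym (vpos-last-row a p)
setSFrom-vpos (a ∷ b ∷ r) p = trans (cong (p ℕ.+ suc a ∷_) (setSFrom-vpos (b ∷ r) (p ℕ.+ suc a)))
                                (sym (vpos-row a p (aWord (b ∷ r))))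

setS-vpos : ∀ α → setS α ≡ vpos 0 (aWord α)
setS-vpos α = trans (setSFrom-0 α) (setSFrom-vpos α 0)

-- The involution ω

replicate-∷ʳ : ∀ a (c : Letter) → replicate a c ∷ʳ c ≡ c ∷ replicate a c
replicate-∷ʳ zero    c = refl
replicate-∷ʳ (suc a) c = cong (c ∷_) (replicate-∷ʳ a c)

reverse-replicate : ∀ a (c : Letter) → reverse (replicate a c) ≡ replicate a c
reverse-replicate zero    c = refl
reverse-replicate (suc a) c =
  trans (unfold-reverse c (replicate a c))
  (trans (cong (_∷ʳ c) (reverse-replicate a c)) (replicate-∷ʳ a c))

aWord-∷ʳ : ∀ α a → α ≢ [] → aWord (α ∷ʳ a) ≡ aWord α ++ v ∷ replicate a h
aWord-∷ʳ []          a ne = ⊥-elim (ne refl)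
aWord-∷ʳ (b ∷ [])    a ne = refl
aWord-∷ʳ (b ∷ c ∷ r) a ne =
  trans (cong (λ z → replicate b h ++ v ∷ z) (aWord-∷ʳ (c ∷ r) a (λ ())))
        (sym (++-assoc (replicate b h) (v ∷ aWord (c ∷ r)) (v ∷ replicate a h)))

reverse-≢[] : ∀ (a : ℕ) r → reverse (a ∷ r) ≢ []
reverse-≢[] a r e with () ← trans (sym (length-reverse (a ∷ r))) (cong length e)

aWord-reverse : ∀ α → aWord (reverse α) ≡ reverse (aWord α)
aWord-reverse []          = refl
aWord-reverse (a ∷ [])    = sym (reverse-replicate a h)
aWord-reverse (a ∷ b ∷ r) = begin
  aWord (reverse (a ∷ b ∷ r))
    ≡⟨ cong aWord (unfold-reverse a (b ∷ r)) ⟩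
  aWord (reverse (b ∷ r) ∷ʳ a)
    ≡⟨ aWord-∷ʳ (reverse (b ∷ r)) a (reverse-≢[] b r) ⟩
  aWord (reverse (b ∷ r)) ++ v ∷ replicate a h
    ≡⟨ cong₂ (λ x y → x ++ v ∷ y) (aWord-reverse (b ∷ r)) (sym (reverse-replicate a h)) ⟩
  reverse (aWord (b ∷ r)) ++ v ∷ reverse (replicate a h)
    ≡⟨ ++-assoc (reverse (aWord (b ∷ r))) (v ∷ []) _ ⟨
  (reverse (aWord (b ∷ r)) ∷ʳ v) ++ reverse (replicate a h)
    ≡⟨ cong (_++ reverse (replicate a h)) (unfold-reverse v (aWord (b ∷ r))) ⟨
  reverse (v ∷ aWord (b ∷ r)) ++ reverse (replicate a h)
    ≡⟨ reverse-++ (replicate a h) (v ∷ aWord (b ∷ r)) ⟨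
  reverse (aWord (a ∷ b ∷ r)) ∎

ρ-reverse : ∀ a → ρ a ≡ map swap (reverse a)
ρ-reverse []      = refl
ρ-reverse (c ∷ a) = begin
  ρ a ∷ʳ swap c                        ≡⟨ cong (_∷ʳ swap c) (ρ-reverse a) ⟩
  map swap (reverse a) ++ swap c ∷ []  ≡⟨ map-++ swap (reverse a) (c ∷ []) ⟨
  map swap (reverse a ∷ʳ c)            ≡⟨ cong (map swap) (unfold-reverse c a) ⟨
  map swap (reverse (c ∷ a))           ∎

filter-cong-All : {Q : ℕ → Set} {p q : ℕ → Bool} {xs : List ℕ} →
  All Q xs → (∀ {x} → Q x → p x ≡ q x) → filter p xs ≡ filter q xs
filter-cong-All []             e = refl
filter-cong-All {p = p} {q} (_∷_ {x} r rs) e rewrite e r with q x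
... | true  = cong (x ∷_) (filter-cong-All rs e)
... | false = filter-cong-All rs e

filter-complement : ∀ b p →
  filter (λ i → not (has i (vpos p b))) (interval p (length b)) ≡ vpos p (map swap b)
filter-complement []      p = refl
filter-complement (h ∷ b) p
  rewrite has-∉ (vpos-above (suc p) b) = cong (suc p ∷_) (filter-complement b (suc p))
filter-complement (v ∷ b) p
  rewrite ≡ᵇ-refl p = trans
    (filter-cong-All (interval-above (suc p) (length b))
      (λ {i} q → cong not (has-∷ {p} {i} (vpos (suc p) b) q)))
    (filter-complement b (suc p))

-- Reversing the rows reverses the word, and complementing the set of positions of v exchanges the
-- letters; together this is `ρ`.
ω-fromWord : ∀ α → α ≢ [] → ω α ≡ fromWord (ρ (aWord α))
ω-fromWord α ne = begin
  compD (size α) (filter (λ i → not (has i (setS (reverse α)))) (range (size α ∸ 1)))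
    ≡⟨ cong (λ n → compD n (filter (λ i → not (has i (setS (reverse α)))) (range (n ∸ 1)))) size-α ⟩
  compD (suc N) (filter (λ i → not (has i (setS (reverse α)))) (range N))
    ≡⟨ cong₂ (λ D I → compD (suc N) (filter (λ i → not (has i D)) I))
         (trans (setS-vpos (reverse α)) (cong (vpos 0) (aWord-reverse α))) (range≡interval N) ⟩
  compD (suc N) (filter (λ i → not (has i (vpos 0 b))) (interval 0 N))
    ≡⟨ cong (λ n → compD (suc n) (filter (λ i → not (has i (vpos 0 b))) (interval 0 n)))
         (length-reverse (aWord α)) ⟨
  compD (suc (length b)) (filter (λ i → not (has i (vpos 0 b))) (interval 0 (length b)))
    ≡⟨ cong₂ (λ n D → compD (suc n) D) (sym (length-map swap b)) (filter-complement b 0) ⟩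
  compD (suc (length (map swap b))) (vpos 0 (map swap b))
    ≡⟨ compD-vpos (map swap b) ⟩
  fromWord (map swap b)
    ≡⟨ cong fromWord (ρ-reverse (aWord α)) ⟨
  fromWord (ρ (aWord α)) ∎
  where
  N = length (aWord α)
  b = reverse (aWord α)
  size-α : size α ≡ suc N
  size-α = trans (cong size (sym (fromWord-aWord α ne))) (size-fromWord (aWord α))

-- Descents and w_α

-- Two versions, because `Cw` tests for descents and `validSVP` for ascents; they disagree on equal
-- neighbours.
descentWord ascentWord : List ℕ → Word
descentWord (x ∷ y ∷ r) = (if y <ᵇ x then v else h) ∷ descentWord (y ∷ r)
descentWord _           = []

ascentWord (x ∷ y ∷ r) = (if x <ᵇ y then h else v) ∷ ascentWord (y ∷ r)
ascentWord _           = []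

length-descentWord : ∀ x r → length (descentWord (x ∷ r)) ≡ length r
length-descentWord x []      = refl
length-descentWord x (y ∷ r) = cong suc (length-descentWord y r)

length-ascentWord : ∀ x r → length (ascentWord (x ∷ r)) ≡ length r
length-ascentWord x []      = refl
length-ascentWord x (y ∷ r) = cong suc (length-ascentWord y r)

descentsFrom-vpos : ∀ x r p → descentsFrom (suc p) (x ∷ r) ≡ vpos p (descentWord (x ∷ r))
descentsFrom-vpos x []      p = refl
descentsFrom-vpos x (y ∷ r) p with y <ᵇ x
... | true  = cong (suc p ∷_) (descentsFrom-vpos y r (suc p))
... | false = descentsFrom-vpos y r (suc p)

Cw-fromWord : ∀ x r → Cw (x ∷ r) ≡ fromWord (descentWord (x ∷ r))
Cw-fromWord x r = begin
  compD (suc (length r)) (descents (x ∷ r))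
    ≡⟨ cong₂ (λ n D → compD (suc n) D) (sym (length-descentWord x r))
         (trans (descentsFrom-1 (x ∷ r)) (descentsFrom-vpos x r 0)) ⟩
  compD (suc (length b)) (vpos 0 b)
    ≡⟨ compD-vpos b ⟩
  fromWord b ∎
  where
  b = descentWord (x ∷ r)

-- Both inequalities are strict, so `descentWord` and `ascentWord` recover the same word. The list
-- is never empty.
data Shape : Word → List ℕ → Set where
  end     : ∀ {x} → Shape [] (x ∷ [])
  ascent  : ∀ {x y b r} → x < y → Shape b (y ∷ r) → Shape (h ∷ b) (x ∷ y ∷ r)
  descent : ∀ {x y b r} → y < x → Shape b (y ∷ r) → Shape (v ∷ b) (x ∷ y ∷ r)

shape-descentWord : ∀ {b u} → Shape b u → descentWord u ≡ b
shape-descentWord end           = refl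
shape-descentWord (ascent q s)  rewrite <ᵇ-false (ℕₚ.<⇒≤ q) = cong (h ∷_) (shape-descentWord s)
shape-descentWord (descent q s) rewrite <ᵇ-true q = cong (v ∷_) (shape-descentWord s)

shape-ascentWord : ∀ {b u} → Shape b u → ascentWord u ≡ b
shape-ascentWord end           = refl
shape-ascentWord (ascent q s)  rewrite <ᵇ-true q = cong (h ∷_) (shape-ascentWord s)
shape-ascentWord (descent q s) rewrite <ᵇ-false (ℕₚ.<⇒≤ q) = cong (v ∷_) (shape-ascentWord s)

-- Every entry of the row is shifted by s and hence exceeds s, which bounds the first entry y of the
-- next row; so the row ends in a descent.
shape-row : ∀ a p s {b y ys} → y ≤ s → Shape b (y ∷ ys) →
  Shape (replicate a h ++ v ∷ b) (map (ℕ._+ s) (interval p (suc a)) ++ y ∷ ys)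
shape-row zero    p s q sh = descent (s≤s (ℕₚ.≤-trans q (ℕₚ.m≤n+m s p))) sh
shape-row (suc a) p s q sh = ascent ℕₚ.≤-refl (shape-row a (suc p) s q sh)

shape-last-row : ∀ a p s → Shape (replicate a h) (map (ℕ._+ s) (interval p (suc a)) ++ [])
shape-last-row zero    p s = end
shape-last-row (suc a) p s = ascent ℕₚ.≤-refl (shape-last-row a (suc p) s)

shape-wα : ∀ α → α ≢ [] → Shape (aWord α) (wα α)
shape-wα []          ne = ⊥-elim (ne refl)
shape-wα (a ∷ [])    ne =
  subst (λ I → Shape (replicate a h) (map (ℕ._+ 0) I ++ [])) (sym (range≡interval (suc a)))
    (shape-last-row a 0 0)
shape-wα (a ∷ b ∷ r) ne =
  subst (λ I → Shape (aWord (a ∷ b ∷ r)) (map (ℕ._+ size (b ∷ r)) I ++ wα (b ∷ r)))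
    (sym (range≡interval (suc a)))
    (shape-row a 0 (size (b ∷ r)) (s≤s (ℕₚ.m≤n+m (size r) b)) (shape-wα (b ∷ r) (λ ())))

validSVP-ascentWord : ∀ x w σ → validSVP (x ∷ w) σ ≡ valid (ascentWord (x ∷ w)) σ
validSVP-ascentWord x []      σ           = refl
validSVP-ascentWord x (y ∷ w) []          = refl
validSVP-ascentWord x (y ∷ w) (s ∷ [])    = refl
validSVP-ascentWord x (y ∷ w) (s ∷ t ∷ σ) with x <ᵇ y
... | true  = cong ((maxL s ≤ᵇ minL t) ∧_) (validSVP-ascentWord y w (t ∷ σ))
... | false = cong ((maxL s <ᵇ minL t) ∧_) (validSVP-ascentWord y w (t ∷ σ))

LtW-count : ∀ x r m → LtW (x ∷ r) m ≡ count 0 (ascentWord (x ∷ r)) m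
LtW-count x r m = begin
  LtW (x ∷ r) m
    ≡⟨ length-filter (λ σ → validSVP (x ∷ r) σ ∧ eqL (content N σ) m)
         (tuples (suc (length r)) (neSubsets N)) ⟩
  ∑ (tuples (suc (length r)) (neSubsets N)) (λ σ → 𝟙 (validSVP (x ∷ r) σ ∧ eqL (content N σ) m))
    ≡⟨ ∑-cong (tuples (suc (length r)) (neSubsets N))
         (λ σ → cong (λ z → 𝟙 (z ∧ eqL (content N σ) m)) (validSVP-ascentWord x r σ)) ⟩
  ∑ (tuples (suc (length r)) (neSubsets N)) (λ σ → 𝟙 (valid b σ ∧ eqL (weight (range N) σ) m))
    ≡⟨ cong₂ (λ n I → ∑ (tuples (suc n) (filter nonemptyᵇ (subsetsOf I)))
                        (λ σ → 𝟙 (valid b σ ∧ eqL (weight I σ) m)))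
         (sym (length-ascentWord x r)) (range≡interval N) ⟩
  count 0 b m ∎
  where
  N = length m
  b = ascentWord (x ∷ r)

LtW-shape : ∀ {b u} → Shape b u → ∀ m → LtW u m ≡ ℒ m b
LtW-shape {b} {x ∷ r} s m =
  trans (LtW-count x r m)
  (trans (cong (λ z → count 0 z m) (shape-ascentWord s)) (count≡ℒ m 0 b))

Lt-fromWord : ∀ b m → Lt (fromWord b) m ≡ ℒ m b
Lt-fromWord b m = LtW-shape
  (subst (λ z → Shape z (wα (fromWord b))) (aWord-fromWord b) (shape-wα (fromWord b) (fromWord-≢[] b))) m

Lt-[] : ∀ m → Lt [] m ≡ onePS m
Lt-[] m =
  trans (length-filter (λ σ → eqL (content (length m) σ) m) (tuples 0 (neSubsets (length m))))
  (trans (ℤₚ.+-identityʳ _)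
         (weight-[] (range (length m)) m
           (trans (cong length (range≡interval (length m))) (length-interval 0 (length m)))))

-- The merging sum

-- Each letter d is either deleted or kept, which is the factor 1 + d of `sub`.
length-filter-masks : ∀ b c →
  + length (filter (λ X → eqWord (deleteAt X b) c) (masks (length b))) ≡ sub b c
length-filter-masks b c = trans
  (length-filter (λ X → eqWord (deleteAt X b) c) (masks (length b)))
  (helper b c)
  where
  empty : ∀ c → 𝟙 (eqWord [] c) + 0ℤ ≡ one c
  empty []      = refl
  empty (_ ∷ _) = refl

  split : ∀ n (f : List Bool → ℤ) →
    ∑ (masks (suc n)) f ≡ ∑ (masks n) (f ∘ (true ∷_)) + ∑ (masks n) (f ∘ (false ∷_))
  split n f = trans (∑-concatMap (λ b → map (b ∷_) (masks n)) f (true ∷ false ∷ []))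
    (cong₂ _+_ (∑-map (true ∷_) f (masks n))
               (trans (ℤₚ.+-identityʳ _) (∑-map (false ∷_) f (masks n))))

  letter : ∀ d e n (f : List Bool → Bool) →
    ∑ (masks n) (λ X → 𝟙 (eqLetter d e ∧ f X)) ≡ δ d e * ∑ (masks n) (𝟙 ∘ f)
  letter h h n f = sym (ℤₚ.*-identityˡ _)
  letter v v n f = sym (ℤₚ.*-identityˡ _)
  letter h v n f = ∑-zero (masks n)
  letter v h n f = ∑-zero (masks n)

  helper : ∀ b c → ∑ (masks (length b)) (λ X → 𝟙 (eqWord (deleteAt X b) c)) ≡ sub b c
  helper []      c  = empty c
  helper (d ∷ b) [] =
    trans (split (length b) (λ X → 𝟙 (eqWord (deleteAt X (d ∷ b)) [])))
    (trans (cong₂ _+_ (helper b []) (∑-zero (masks (length b))))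
    (trans (ℤₚ.+-identityʳ _) (sym (ℤₚ.*-identityˡ _))))
  helper (d ∷ b) (e ∷ c) =
    trans (split (length b) (λ X → 𝟙 (eqWord (deleteAt X (d ∷ b)) (e ∷ c))))
    (cong₂ _+_ (trans (helper b (e ∷ c)) (sym (ℤₚ.*-identityˡ _)))
               (trans (letter d e (length b) (λ X → eqWord (deleteAt X b) c))
                      (cong (δ d e *_) (helper b c))))

M-sub : ∀ α β → α ≢ [] → β ≢ [] → + M α β ≡ sub (aWord α) (aWord β)
M-sub []      β       ne ne′ = ⊥-elim (ne refl)
M-sub (a ∷ r) []      ne ne′ = ⊥-elim (ne′ refl)
M-sub (a ∷ r) (b ∷ s) ne ne′ = length-filter-masks (aWord (a ∷ r)) (aWord (b ∷ s))

M-[] : ∀ β → β ≢ [] → M [] β ≡ 0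
M-[] []      ne = ⊥-elim (ne refl)
M-[] (_ ∷ _) ne = refl

subsetsOf-interval : ∀ p n → subsetsOf (interval p n) ≡ map (vpos p) (words n)
subsetsOf-interval p zero    = refl
subsetsOf-interval p (suc n) = begin
  subsetsOf (interval (suc p) n) ++ map (suc p ∷_) (subsetsOf (interval (suc p) n))
    ≡⟨ cong (λ z → z ++ map (suc p ∷_) z) (subsetsOf-interval (suc p) n) ⟩
  map (vpos (suc p)) (words n) ++ map (suc p ∷_) (map (vpos (suc p)) (words n))
    ≡⟨ cong₂ _++_ (map-∘ (words n)) (trans (sym (map-∘ (words n))) (map-∘ (words n))) ⟩
  map (vpos p) (map (h ∷_) (words n)) ++ map (vpos p) (map (v ∷_) (words n))
    ≡⟨ map-++ (vpos p) (map (h ∷_) (words n)) (map (v ∷_) (words n)) ⟨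
  map (vpos p) (words (suc n)) ∎

words-length : ∀ n → All (λ b → length b ≡ n) (words n)
words-length zero    = refl ∷ []
words-length (suc n) = All-++⁺ (All-map⁺ (All.map (cong suc) (words-length n)))
                               (All-map⁺ (All.map (cong suc) (words-length n)))

∑-compositionsOf : ∀ n f → ∑ (compositionsOf (suc n)) f ≡ ∑ (words n) (f ∘ fromWord)
∑-compositionsOf n f = begin
  ∑ (map (compD (suc n)) (subsetsOf (range n))) f
    ≡⟨ cong (λ z → ∑ (map (compD (suc n)) z) f)
         (trans (cong subsetsOf (range≡interval n)) (subsetsOf-interval 0 n)) ⟩
  ∑ (map (compD (suc n)) (map (vpos 0) (words n))) f
    ≡⟨ trans (∑-map (compD (suc n)) f (map (vpos 0) (words n)))
             (∑-map (vpos 0) (f ∘ compD (suc n)) (words n)) ⟩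
  ∑ (words n) (λ b → f (compD (suc n) (vpos 0 b)))
    ≡⟨ ∑-cong-All (words-length n) (λ { b refl → cong f (compD-vpos b) }) ⟩
  ∑ (words n) (f ∘ fromWord) ∎

ΣL-P : ∀ g m → ΣL (λ β → sgn (size β) * + M β (fromWord g)) m ≡ P m g
ΣL-P g m = begin
  ∑ (compositionsUpTo d) f
    ≡⟨ trans (∑-concatMap compositionsOf f (upTo (suc d)))
             (∑-applyUpTo (λ n → ∑ (compositionsOf n) f) (λ n → n) (suc d)) ⟩
  ∑ (compositionsOf 0) f + ∑< d (λ n → ∑ (compositionsOf (suc n)) f)
    ≡⟨ cong₂ _+_ empty (∑<-cong d step) ⟩
  0ℤ + P m g
    ≡⟨ ℤₚ.+-identityˡ _ ⟩
  P m g ∎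
  where
  d = degree m

  f : Composition → ℤ
  f β = sgn (size β) * + M β (fromWord g) * Lt β m

  -- The empty composition does not merge to a nonempty one. Sizes 1 to d then correspond to word
  -- lengths 0 to d - 1.
  empty : ∑ (compositionsOf 0) f ≡ 0ℤ
  empty = trans (ℤₚ.+-identityʳ _)
    (cong (λ z → 1ℤ * + z * Lt [] m) (M-[] (fromWord g) (fromWord-≢[] g)))

  merge : ∀ b → + M (fromWord b) (fromWord g) ≡ sub b g
  merge b = trans (M-sub (fromWord b) (fromWord g) (fromWord-≢[] b) (fromWord-≢[] g))
                  (cong₂ sub (aWord-fromWord b) (aWord-fromWord g))

  step : ∀ n → ∑ (compositionsOf (suc n)) f ≡ Φ n (ℒ m) g
  step n = begin
    ∑ (compositionsOf (suc n)) f
      ≡⟨ ∑-compositionsOf n f ⟩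
    ∑ (words n) (f ∘ fromWord)
      ≡⟨ ∑-cong-All (words-length n) (λ { b refl →
           cong₂ _*_ (cong₂ _*_ (cong sgn (size-fromWord b)) (merge b)) (Lt-fromWord b m) }) ⟩
    ∑ (words n) (λ b → sgn (suc n) * sub b g * ℒ m b)
      ≡⟨ Φ-words n (ℒ m) g ⟨
    Φ n (ℒ m) g ∎

-- The antipode equation

⋆-+ʳ : ∀ f g g′ m → (f ⋆ (λ n → g n + g′ n)) m ≡ (f ⋆ g) m + (f ⋆ g′) m
⋆-+ʳ f g g′ m =
  trans (∑-cong (below m) (λ a → lemma₁ (f a) (g (zipWith _∸_ m a)) (g′ (zipWith _∸_ m a))))
  (trans (∑-linear (below m) 1ℤ 1ℤ _ _)
         (cong₂ _+_ (ℤₚ.*-identityˡ ((f ⋆ g) m)) (ℤₚ.*-identityˡ ((f ⋆ g′) m))))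
  where
  lemma₁ : ∀ p q r → p * (q + r) ≡ 1ℤ * (p * q) + 1ℤ * (p * r)
  lemma₁ = solve-∀

module Antipode (S : Composition → PS) (axiom : IsAntipode S) where

  S-[] : ∀ m → S [] m ≡ onePS m
  S-[] m = begin
    S [] m                  ≡⟨ ⋆-identityˡ (S []) m ⟨
    (onePS ⋆ S []) m        ≡⟨ ⋆-cong {g = S []} Lt-[] (λ _ → refl) m ⟨
    (Lt [] ⋆ S []) m        ≡⟨ ℤₚ.+-identityʳ _ ⟨
    (Lt [] ⋆ S []) m + 0ℤ   ≡⟨ proj₂ (axiom []) m ⟩
    onePS m                 ∎

  X : WordPS
  X a m = one a * onePS m + 𝐄 (λ b → S (fromWord b) m) a

  -- The right pieces of the two cuts at an entry x: a cut after x omits it, a cut at x repeats it.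
  -- If x is the last entry, the former piece is empty and its antipode 1 is the constant term 1 of
  -- X; otherwise the two pieces are the two terms of E S, as in `X-∷`.
  X-[] : ∀ x → X [] ≗ (λ m → S (Cw []) m + S (Cw (x ∷ [])) m)
  X-[] x m = cong₂ _+_ (trans (ℤₚ.*-identityˡ _) (sym (S-[] m))) (ℤₚ.*-identityˡ _)

  X-∷ : ∀ x y r → X (descentWord (x ∷ y ∷ r)) ≗ (λ m → S (Cw (y ∷ r)) m + S (Cw (x ∷ y ∷ r)) m)
  X-∷ x y r m = trans
    (lemma (onePS m) (S (fromWord (descentWord (x ∷ y ∷ r))) m) (S (fromWord (descentWord (y ∷ r))) m))
    (sym (cong₂ (λ α β → S α m + S β m) (Cw-fromWord y r) (Cw-fromWord x (y ∷ r))))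
    where
    lemma : ∀ s p q → 0ℤ * s + (1ℤ * p + 1ℤ * q) ≡ q + p
    lemma = solve-∀

  -- Both cuts at an entry have the same left piece, so their right pieces add up to a value of X.
  -- The letters of the left piece are absorbed into `F`, which makes the statement inductive.
  cuts : ∀ (F : WordPS) x r m →
    ∑< (suc (length r)) (λ i → (F (descentWord (x ∷ take i r)) ⋆ S (Cw (drop i r))) m) +
    ∑< (suc (length r)) (λ i → (F (descentWord (x ∷ take i r)) ⋆ S (Cw (drop i (x ∷ r)))) m)
    ≡ (F ⊛ X) (descentWord (x ∷ r)) m
  cuts F x [] m =
    trans (cong₂ _+_ (ℤₚ.+-identityʳ ((F [] ⋆ S (Cw [])) m))
                     (ℤₚ.+-identityʳ ((F [] ⋆ S (Cw (x ∷ []))) m)))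
    (trans (sym (⋆-+ʳ (F []) (S (Cw [])) (S (Cw (x ∷ []))) m))
           (sym (⋆-cong {f = F []} (λ _ → refl) (X-[] x) m)))
  cuts F x (y ∷ r) m =
    trans (lemma ((F [] ⋆ S (Cw (y ∷ r))) m) _ ((F [] ⋆ S (Cw (x ∷ y ∷ r))) m) _)
    (cong₂ _+_
      (trans (sym (⋆-+ʳ (F []) (S (Cw (y ∷ r))) (S (Cw (x ∷ y ∷ r))) m))
             (sym (⋆-cong {f = F []} (λ _ → refl) (X-∷ x y r) m)))
      (cuts (F ∘ ((if y <ᵇ x then v else h) ∷_)) y r m))
    where
    lemma : ∀ p q r s → p + q + (r + s) ≡ p + r + (q + s)
    lemma = solve-∀

  coproduct : ∀ α x r → wα α ≡ x ∷ r → ∀ m →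
    sumPS (map (λ p → Lt (proj₁ p) ⋆ S (proj₂ p)) (coprodTerms α)) m
    ≡ S (Cw (x ∷ r)) m + ((λ b n → ℒ n b) ⊛ X) (descentWord (x ∷ r)) m
  coproduct α x r e m = begin
    sumPS (map (λ p → Lt (proj₁ p) ⋆ S (proj₂ p)) (coprodTerms α)) m
      ≡⟨ ∑-map (λ p → Lt (proj₁ p) ⋆ S (proj₂ p)) (λ g → g m) (coprodTerms α) ⟩
    ∑ (coprodTerms α) f
      ≡⟨ cong (λ u → ∑ (map (cut u) (upTo (suc (length u))) ++ map (cut′ u) (range (length u))) f) e ⟩
    ∑ (map (cut w) (upTo (suc n)) ++ map (cut′ w) (range n)) f
      ≡⟨ ∑-++ f (map (cut w) (upTo (suc n))) (map (cut′ w) (range n)) ⟩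
    ∑ (map (cut w) (upTo (suc n))) f + ∑ (map (cut′ w) (range n)) f
      ≡⟨ cong₂ _+_
           (trans (∑-map (cut w) f (upTo (suc n))) (∑-applyUpTo (f ∘ cut w) (λ i → i) (suc n)))
           (trans (∑-map (cut′ w) f (range n))
           (trans (∑-map suc (f ∘ cut′ w) (upTo n)) (∑-applyUpTo (f ∘ cut′ w ∘ suc) (λ i → i) n))) ⟩
    -- The cut at index 0, with empty left piece, is split off; then both kinds of cuts run over the
    -- n entries of w.
    (Lt [] ⋆ S (Cw w)) m + ∑< n (λ i → (Lt (Cw (x ∷ take i r)) ⋆ S (Cw (drop i r))) m) +
    ∑< n (λ i → (Lt (Cw (x ∷ take i r)) ⋆ S (Cw (drop i (x ∷ r)))) m)
      ≡⟨ ℤₚ.+-assoc ((Lt [] ⋆ S (Cw w)) m) _ _ ⟩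
    (Lt [] ⋆ S (Cw w)) m + (∑< n (λ i → (Lt (Cw (x ∷ take i r)) ⋆ S (Cw (drop i r))) m) +
    ∑< n (λ i → (Lt (Cw (x ∷ take i r)) ⋆ S (Cw (drop i (x ∷ r)))) m))
      ≡⟨ cong₂ _+_ (trans (⋆-cong {g = S (Cw w)} Lt-[] (λ _ → refl) m) (⋆-identityˡ (S (Cw w)) m))
           (cong₂ _+_ (∑<-cong n (λ i → ⋆-cong {g = S (Cw (drop i r))} (Lt-Cw i) (λ _ → refl) m))
                      (∑<-cong n (λ i → ⋆-cong {g = S (Cw (drop i w))} (Lt-Cw i) (λ _ → refl) m))) ⟩
    S (Cw w) m + (∑< n (λ i → (L (descentWord (x ∷ take i r)) ⋆ S (Cw (drop i r))) m) +
    ∑< n (λ i → (L (descentWord (x ∷ take i r)) ⋆ S (Cw (drop i (x ∷ r)))) m))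
      ≡⟨ cong (λ z → S (Cw w) m + z) (cuts L x r m) ⟩
    S (Cw w) m + (L ⊛ X) (descentWord w) m ∎
    where
    w = x ∷ r
    n = length w

    L : WordPS
    L b n = ℒ n b

    cut cut′ : List ℕ → ℕ → Composition × Composition
    cut u i  = Cw (take i u) , Cw (drop i u)
    cut′ u i = Cw (take i u) , Cw (drop (i ∸ 1) u)

    f : Composition × Composition → ℤ
    f p = (Lt (proj₁ p) ⋆ S (proj₂ p)) m

    Lt-Cw : ∀ i → Lt (Cw (x ∷ take i r)) ≗ L (descentWord (x ∷ take i r))
    Lt-Cw i k = trans (cong (λ z → Lt z k) (Cw-fromWord x (take i r)))
                      (Lt-fromWord (descentWord (x ∷ take i r)) k)

  S-equation : ∀ a m → S (fromWord a) m + ((λ b n → ℒ n b) ⊛ X) a m ≡ 0ℤ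
  S-equation a m = go (wα α) refl
    where
    α = fromWord a
    shape : Shape a (wα α)
    shape = subst (λ z → Shape z (wα α)) (aWord-fromWord a) (shape-wα α (fromWord-≢[] a))

    ε-zero : ∀ β → β ≢ [] → εL β m ≡ 0ℤ
    ε-zero []      ne = ⊥-elim (ne refl)
    ε-zero (_ ∷ _) ne = refl

    -- The permutation is replaced by a variable so that it can be split into head and tail; `Shape`
    -- rules out the empty list.
    go : ∀ w → wα α ≡ w → S α m + ((λ b n → ℒ n b) ⊛ X) a m ≡ 0ℤ
    go [] e with () ← subst (Shape a) e shape
    go (x ∷ r) e = begin
      S α m + ((λ b n → ℒ n b) ⊛ X) a m
        ≡⟨ cong (λ b → S (fromWord b) m + ((λ b n → ℒ n b) ⊛ X) b m)
             (shape-descentWord (subst (Shape a) e shape)) ⟨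
      S (fromWord (descentWord (x ∷ r))) m + ((λ b n → ℒ n b) ⊛ X) (descentWord (x ∷ r)) m
        ≡⟨ cong (λ β → S β m + ((λ b n → ℒ n b) ⊛ X) (descentWord (x ∷ r)) m) (Cw-fromWord x r) ⟨
      S (Cw (x ∷ r)) m + ((λ b n → ℒ n b) ⊛ X) (descentWord (x ∷ r)) m
        ≡⟨ coproduct α x r e m ⟨
      sumPS (map (λ p → Lt (proj₁ p) ⋆ S (proj₂ p)) (coprodTerms α)) m
        ≡⟨ proj₂ (axiom α) m ⟩
      εL α m
        ≡⟨ ε-zero α (fromWord-≢[] a) ⟩
      0ℤ ∎

  X-equation : ∀ a m → X a m + 𝐄 (λ b → ((λ c n → ℒ n c) ⊛ X) b m) a ≡ one a * onePS m
  X-equation a m = begin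
    X a m + 𝐄 (λ b → ((λ c n → ℒ n c) ⊛ X) b m) a
      ≡⟨ ℤₚ.+-assoc (one a * onePS m) _ _ ⟩
    one a * onePS m + (𝐄 (λ b → S (fromWord b) m) a + 𝐄 (λ b → ((λ c n → ℒ n c) ⊛ X) b m) a)
      ≡⟨ cong (λ z → one a * onePS m + z) (lin-+ 1ℤ (const 1ℤ) _ _ a) ⟨
    one a * onePS m + 𝐄 (λ b → S (fromWord b) m + ((λ c n → ℒ n c) ⊛ X) b m) a
      ≡⟨ cong (λ z → one a * onePS m + z) (lin-zero 1ℤ (const 1ℤ) (λ b → S-equation b m) a) ⟩
    one a * onePS m + 0ℤ
      ≡⟨ ℤₚ.+-identityʳ _ ⟩
    one a * onePS m ∎

  S-fromWord : ∀ a m → S (fromWord a) m ≡ Pᵗ m a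
  S-fromWord a m = 𝐄-cancel 𝐄S≗𝐄P a
    where
    𝐄S≗𝐄P : 𝐄 (λ b → S (fromWord b) m) ≗ 𝐄 (Pᵗ m)
    𝐄S≗𝐄P b = ∙-cancelˡ ℤₚ.+-0-abelianGroup (one b * onePS m) _ _
      (trans (convolution-inverse X one X-equation m b) (𝒯-one≗Pᵗ m b))

theorem4p8 : (S : Composition → PS) → IsAntipode S →
    (α : Composition) → α ≢ [] →
    S α ≈ ΣL (λ β → sgn (size β) * + M β (ω α))
theorem4p8 S axiom α ne m = begin
  S α m
    ≡⟨ cong (λ β → S β m) (fromWord-aWord α ne) ⟨
  S (fromWord (aWord α)) m
    ≡⟨ Antipode.S-fromWord S axiom (aWord α) m ⟩
  P m (ρ (aWord α))
    ≡⟨ ΣL-P (ρ (aWord α)) m ⟨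
  ΣL (λ β → sgn (size β) * + M β (fromWord (ρ (aWord α)))) m
    ≡⟨ cong (λ γ → ΣL (λ β → sgn (size β) * + M β γ) m) (ω-fromWord α ne) ⟨
  ΣL (λ β → sgn (size β) * + M β (ω α)) m ∎
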